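{- Let $q=p^h$, $p$ prime, $n\ge2$ and $0<k\le n-1$. Then $d(C_k(n,q)^\perp)=d(C_1(n-k+1,q)^\perp)$.
   Context: For $1\le k\le m-1$, $C_k(m,q)$ is the $p$-ary linear code spanned over $\mathbb{F}_p$ by the rows of the incidence matrix of $k$-dimensional subspaces versus points of $PG(m,q)$ (entry $1$ iff the point lies in the subspace), $C_k(m,q)^\perp$ its dual code with respect to the standard scalar product, and $d(C)$ denotes the minimum weight (number of nonzero coordinates) of a nonzero codeword of $C$. -}

module Defs where

open import Data.Nat using (ℕ; zero; suc; _+_; _*_; _≤_; NonZero)
open import Data.Nat.DivMod using (_%_)
open import Data.Fin as Fin using (Fin; toℕ)
open import Data.Fin.Properties using () renaming (_≟_ to _≟F_)
open import Data.Vec using (Vec; []; _∷_; replicate; zipWith)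
open import Data.List as List using (List; []; _∷_; map; concatMap; mapMaybe; allFin; length)
open import Data.Nat.ListAction using (sum)
open import Data.List.Relation.Unary.All using (All)
open import Data.Maybe using (Maybe; just; nothing)
open import Data.Bool using (Bool; true; false; if_then_else_; T)
open import Data.Bool.Properties using (T?)
open import Data.Product using (Σ; ∃; ∃-syntax; _×_; _,_; proj₁; proj₂)
open import Relation.Nullary using (¬_; Dec; yes; no; does)
open import Relation.Binary.PropositionalEquality using (_≡_; _≢_)
open import Function.Bundles using (_↔_; Inverse)
open import Algebra.Structures using (IsCommutativeRing)

record FiniteField (q : ℕ) : Set₁ where
  field
    Carrier : Set
    _+ᶠ_ _*ᶠ_ : Carrier → Carrier → Carrier
    -ᶠ_ : Carrier → Carrier
    0ᶠ 1ᶠ : Carrier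
    isCommutativeRing : IsCommutativeRing _≡_ _+ᶠ_ _*ᶠ_ -ᶠ_ 0ᶠ 1ᶠ
    0≢1 : 0ᶠ ≢ 1ᶠ
    inverse : ∀ x → x ≢ 0ᶠ → ∃[ y ] (x *ᶠ y ≡ 1ᶠ)
    enum : Carrier ↔ Fin q

module Geometry {q : ℕ} (F : FiniteField q) (p : ℕ) .{{_ : NonZero p}} where
  open FiniteField F

  _==_ : Carrier → Carrier → Bool
  x == y = does (Inverse.to enum x ≟F Inverse.to enum y)

  allElems : List Carrier
  allElems = map (Inverse.from enum) (allFin q)

  allVecs : (n : ℕ) → List (Vec Carrier n)
  allVecs zero = [] ∷ []
  allVecs (suc n) = concatMap (λ x → map (x ∷_) (allVecs n)) allElems

  isNorm : ∀ {n} → Vec Carrier n → Bool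
  isNorm [] = false
  isNorm (x ∷ v) = if x == 0ᶠ then isNorm v else x == 1ᶠ

  -- points of PG(m,q): normalized nonzero vectors of F_q^(m+1)
  Point : ℕ → Set
  Point m = Σ (Vec Carrier (suc m)) (λ v → T (isNorm v))

  toPoint : ∀ {m} → Vec Carrier (suc m) → Maybe (Point m)
  toPoint v with T? (isNorm v)
  ... | yes t = just (v , t)
  ... | no _ = nothing

  allPoints : (m : ℕ) → List (Point m)
  allPoints m = mapMaybe toPoint (allVecs (suc m))

  _·ᵛ_ : ∀ {n} → Carrier → Vec Carrier n → Vec Carrier n
  a ·ᵛ v = Data.Vec.map (a *ᶠ_) v

  _+ᵛ_ : ∀ {n} → Vec Carrier n → Vec Carrier n → Vec Carrier n
  _+ᵛ_ = zipWith _+ᶠ_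

  linComb : ∀ {n r} → Vec Carrier r → Vec (Vec Carrier n) r → Vec Carrier n
  linComb [] [] = replicate _ 0ᶠ
  linComb (a ∷ as) (b ∷ bs) = (a ·ᵛ b) +ᵛ linComb as bs

  Independent : ∀ {n r} → Vec (Vec Carrier n) r → Set
  Independent {n} {r} bs = ∀ (λs : Vec Carrier r) → linComb λs bs ≡ replicate n 0ᶠ → λs ≡ replicate r 0ᶠ

  -- a k-dimensional projective subspace of PG(m,q), given by a basis of
  -- the corresponding (k+1)-dimensional vector subspace of F_q^(m+1)
  Subspace : ℕ → ℕ → Set
  Subspace m k = Σ (Vec (Vec Carrier (suc m)) (suc k)) Independent

  _∈S_ : ∀ {m k} → Point m → Subspace m k → Set
  P ∈S S = ∃[ λs ] (linComb λs (proj₁ S) ≡ proj₁ P)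

  Word : ℕ → Set
  Word m = Point m → Fin p

  IsIncidenceVector : ∀ {m k} → Subspace m k → Word m → Set
  IsIncidenceVector S v = ∀ P → (P ∈S S → toℕ (v P) ≡ 1) × (¬ (P ∈S S) → toℕ (v P) ≡ 0)

  Span : ∀ {m} → (Word m → Set) → Word m → Set
  Span {m} G c = ∃[ L ] (All (λ av → G (proj₂ av)) L ×
      (∀ (P : Point m) → toℕ (c P) ≡ sum (map (λ (av : Fin p × Word m) → toℕ (proj₁ av) * toℕ (proj₂ av P)) L) % p))

  Code : (m k : ℕ) → Word m → Set
  Code m k = Span (λ v → ∃[ S ] IsIncidenceVector {m} {k} S v)

  inner : ∀ {m} → Word m → Word m → ℕ
  inner {m} c c' = sum (map (λ P → toℕ (c P) * toℕ (c' P)) (allPoints m)) % p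

  Dual : ∀ {m} → (Word m → Set) → Word m → Set
  Dual C c = ∀ c' → C c' → inner c c' ≡ 0

  weight : ∀ {m} → Word m → ℕ
  weight {m} c = sum (map (λ P → if does (toℕ (c P) Data.Nat.≟ 0) then 0 else 1) (allPoints m))

  NonZeroWord : ∀ {m} → Word m → Set
  NonZeroWord c = ∃[ P ] (toℕ (c P) ≢ 0)

  IsMinWeight : ∀ {m} → (Word m → Set) → ℕ → Set
  IsMinWeight C d = (∃[ c ] (C c × NonZeroWord c × weight c ≡ d)) ×
                    (∀ c → C c → NonZeroWord c → d ≤ weight c)

{-# OPTIONS --safe #-}
module Submission where

-- A word of the dual code is encoded as a function f on the whole vector space that is invariant under
-- nonzero scalars and vanishes mod p at 0. Summing over vectors multiplies sums over points by q - 1, and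
-- f is orthogonal to all k-spaces iff its sum over the image of every linear map F^(k+1) → F^(n+1) is
-- 0 mod p: injectivity may be dropped because the fibres of a non-injective map have size divisible by q.
-- Extending f by zero raises n and k together and keeps the support. Conversely, projecting f from
-- a point outside its support lowers n and k together without enlarging the support; the result is nonzero if
-- the point lies on a tangent line. If a point of the support has no tangent, then the support is at least as
-- large as the number of lines through that point, hence as any support in PG(n-k+1,q) once k ≥ 2.

open import Defs
open import Algebra.Bundles using (CommutativeRing)
import Algebra.Properties.Ring
open import Data.Bool using (T; if_then_else_)
open import Data.Bool.Properties using (T?; T-irrelevant)
open import Data.Fin as Fin using (Fin; toℕ)
open import Data.Fin.Properties using (toℕ-fromℕ<; toℕ<n) renaming (_≟_ to _≟F_; any? to anyF?; suc-injective to Fin-suc-injective)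
open import Data.List as List using (List; []; _∷_; _++_; map; concatMap; mapMaybe; length; tabulate; allFin)
open import Data.List.Membership.Propositional using (_∈_; lose; find)
open import Data.List.Membership.Propositional.Properties using (∈-map⁺; ∈-allFin; ∈-concatMap⁺)
open import Data.List.Properties using (map-cong; map-∘; map-++; map-tabulate; length-map; length-tabulate)
open import Data.List.Relation.Unary.All as All using (All; []; _∷_)
open import Data.List.Relation.Unary.Any using (Any; here; there; any?; index)
open import Data.List.Relation.Unary.Any.Properties using (lookup-index)
open import Data.Maybe using (Maybe; just; nothing; maybe′)
open import Data.Nat as ℕ hiding (_≟_)
open import Data.Nat.Divisibility
open import Data.Nat.DivMod
open import Data.Nat.Induction using (<-wellFounded)
open import Data.Nat.ListAction using (sum)
open import Data.Nat.ListAction.Properties using (sum-++)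
open import Data.Nat.Primality using (Prime; prime⇒nonTrivial)
open import Data.Nat.Properties hiding (_≟_)
open import Algebra.Properties.CommutativeSemigroup +-commutativeSemigroup using (interchange)
open import Data.Product using (∃; ∃-syntax; _×_; _,_; proj₁; proj₂)
open import Data.Sum using (_⊎_; inj₁; inj₂)
open import Data.Vec as Vec using (Vec; []; _∷_; replicate; head; tail)
import Data.Vec.Properties as Vec
open import Function using (_∘_)
open import Function.Bundles using (Inverse; Injection)
open import Function.Properties.Inverse using (↔⇒↣)
open import Induction.WellFounded using (Acc; acc)
open import Level using (0ℓ)
open import Relation.Binary.Definitions using (DecidableEquality)
open import Relation.Binary.PropositionalEquality
open import Relation.Nullary using (Dec; yes; no; does; ¬_; ¬?; contradiction; _×-dec_; _→-dec_)
open import Relation.Nullary.Decidable using (map′; decidable-stable; dec-true; dec-false)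

private
  variable
    A B : Set
    P Q PQ : Set

-- Finite sums of natural numbers, and their divisibility.

∑ : List A → (A → ℕ) → ℕ
∑ xs f = sum (map f xs)

∑-cong : ∀ (xs : List A) {f g : A → ℕ} → f ≗ g → ∑ xs f ≡ ∑ xs g
∑-cong xs f≗g = cong sum (map-cong f≗g xs)

∑-+ : ∀ (xs : List A) (f g : A → ℕ) → ∑ xs (λ x → f x + g x) ≡ ∑ xs f + ∑ xs g
∑-+ [] f g = refl
∑-+ (x ∷ xs) f g = trans (cong (f x + g x +_) (∑-+ xs f g)) (interchange (f x) (g x) _ _)

∑-*ˡ : ∀ (xs : List A) a (f : A → ℕ) → ∑ xs (λ x → a * f x) ≡ a * ∑ xs f
∑-*ˡ [] a f = sym (*-zeroʳ a)
∑-*ˡ (x ∷ xs) a f = trans (cong (a * f x +_) (∑-*ˡ xs a f)) (sym (*-distribˡ-+ a (f x) _))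

∑-const : ∀ (xs : List A) a → ∑ xs (λ _ → a) ≡ length xs * a
∑-const [] a = refl
∑-const (x ∷ xs) a = cong (a +_) (∑-const xs a)

∑-zero : ∀ (xs : List A) {f : A → ℕ} → (∀ x → f x ≡ 0) → ∑ xs f ≡ 0
∑-zero [] h = refl
∑-zero (x ∷ xs) h = cong₂ _+_ (h x) (∑-zero xs h)

∑-swap : ∀ (xs : List A) (ys : List B) (f : A → B → ℕ) →
  ∑ xs (λ x → ∑ ys (f x)) ≡ ∑ ys (λ y → ∑ xs (λ x → f x y))
∑-swap [] ys f = sym (∑-zero ys (λ _ → refl))
∑-swap (x ∷ xs) ys f = trans (cong (∑ ys (f x) +_) (∑-swap xs ys f)) (sym (∑-+ ys (f x) _))

∑-mono : ∀ (xs : List A) {f g : A → ℕ} → (∀ x → f x ≤ g x) → ∑ xs f ≤ ∑ xs g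
∑-mono [] h = z≤n
∑-mono (x ∷ xs) h = +-mono-≤ (h x) (∑-mono xs h)

∑-∣ : ∀ {d} (xs : List A) {f : A → ℕ} → (∀ x → d ∣ f x) → d ∣ ∑ xs f
∑-∣ [] h = _ ∣0
∑-∣ (x ∷ xs) h = ∣m∣n⇒∣m+n (h x) (∑-∣ xs h)

∑-∣-All : ∀ {d} {xs : List A} {f : A → ℕ} → All (λ x → d ∣ f x) xs → d ∣ ∑ xs f
∑-∣-All [] = _ ∣0
∑-∣-All (h ∷ hs) = ∣m∣n⇒∣m+n h (∑-∣-All hs)

∑-map : ∀ (g : B → A) (xs : List B) (f : A → ℕ) → ∑ (map g xs) f ≡ ∑ xs (f ∘ g)
∑-map g xs f = cong sum (sym (map-∘ xs))

∑-concatMap : ∀ (g : B → List A) (xs : List B) (f : A → ℕ) →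
  ∑ (concatMap g xs) f ≡ ∑ xs (λ x → ∑ (g x) f)
∑-concatMap g [] f = refl
∑-concatMap g (x ∷ xs) f = begin
  sum (map f (g x ++ concatMap g xs)) ≡⟨ cong sum (map-++ f (g x) _) ⟩
  sum (map f (g x) ++ map f (concatMap g xs)) ≡⟨ sum-++ (map f (g x)) _ ⟩
  ∑ (g x) f + ∑ (concatMap g xs) f ≡⟨ cong (∑ (g x) f +_) (∑-concatMap g xs f) ⟩
  ∑ (g x) f + ∑ xs (λ x → ∑ (g x) f) ∎
  where open ≡-Reasoning

∑-mapMaybe : ∀ (g : B → Maybe A) (xs : List B) (f : A → ℕ) →
  ∑ (mapMaybe g xs) f ≡ ∑ xs (λ x → maybe′ f 0 (g x))
∑-mapMaybe g [] f = refl
∑-mapMaybe g (x ∷ xs) f with g x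
... | just y = cong (f y +_) (∑-mapMaybe g xs f)
... | nothing = ∑-mapMaybe g xs f

∑-%-cong : ∀ d .{{_ : NonZero d}} (xs : List A) {f g : A → ℕ} →
  (∀ x → f x % d ≡ g x % d) → ∑ xs f % d ≡ ∑ xs g % d
∑-%-cong d [] h = refl
∑-%-cong d (x ∷ xs) {f} {g} h = begin
  (f x + ∑ xs f) % d ≡⟨ %-distribˡ-+ (f x) (∑ xs f) d ⟩
  (f x % d + ∑ xs f % d) % d ≡⟨ cong₂ (λ a b → (a + b) % d) (h x) (∑-%-cong d xs h) ⟩
  (g x % d + ∑ xs g % d) % d ≡⟨ %-distribˡ-+ (g x) (∑ xs g) d ⟨
  (g x + ∑ xs g) % d ∎
  where open ≡-Reasoning

∣-resp-% : ∀ d .{{_ : NonZero d}} {m n} → m % d ≡ n % d → d ∣ m → d ∣ n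
∣-resp-% d {m} {n} eq d∣m = m%n≡0⇒n∣m n d (trans (sym eq) (n∣m⇒m%n≡0 m d d∣m))

*-%ʳ : ∀ d .{{_ : NonZero d}} a b → (a * (b % d)) % d ≡ (a * b) % d
*-%ʳ d a b = begin
  (a * (b % d)) % d ≡⟨ %-distribˡ-* a (b % d) d ⟩
  ((a % d) * (b % d % d)) % d ≡⟨ cong (λ z → ((a % d) * z) % d) (m%n%n≡m%n b d) ⟩
  ((a % d) * (b % d)) % d ≡⟨ %-distribˡ-* a b d ⟨
  (a * b) % d ∎
  where open ≡-Reasoning

-- Indicators and sums over finite types.

𝟙 : Dec P → ℕ
𝟙 (yes _) = 1
𝟙 (no _) = 0

𝟙-cong : (P → Q) → (Q → P) → (d : Dec P) (e : Dec Q) → 𝟙 d ≡ 𝟙 e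
𝟙-cong f g (yes _) (yes _) = refl
𝟙-cong f g (yes a) (no ¬b) = contradiction (f a) ¬b
𝟙-cong f g (no ¬a) (yes b) = contradiction (g b) ¬a
𝟙-cong f g (no _) (no _) = refl

𝟙-yes : (d : Dec P) → P → 𝟙 d ≡ 1
𝟙-yes (yes _) a = refl
𝟙-yes (no ¬a) a = contradiction a ¬a

𝟙-no : (d : Dec P) → ¬ P → 𝟙 d ≡ 0
𝟙-no (yes a) ¬a = contradiction a ¬a
𝟙-no (no _) ¬a = refl

-- `∑-δ` says that each element is listed exactly once, in the form in which the sums use it;
-- `complete` serves the exhaustive searches.
record Listing (A : Set) : Set where
  field
    elems : List A
    _≟_ : DecidableEquality A
    complete : ∀ a → a ∈ elems
    ∑-δ : ∀ a (f : A → ℕ) → ∑ elems (λ x → 𝟙 (x ≟ a) * f x) ≡ f a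

  -- Expand `f (to x)` as a sum over `y` weighted by the indicator of `y ≡ to x`, swap the sums, and
  -- read the same indicator as that of `x ≡ from y`.
  ∑-reindex : (to from : A → A) → (∀ x → from (to x) ≡ x) → (∀ x → to (from x) ≡ x) →
    ∀ f → ∑ elems (f ∘ to) ≡ ∑ elems f
  ∑-reindex to from from∘to to∘from f = begin
    ∑ elems (f ∘ to)
      ≡⟨ ∑-cong elems (λ x → sym (∑-δ (to x) f)) ⟩
    ∑ elems (λ x → ∑ elems (λ y → 𝟙 (y ≟ to x) * f y))
      ≡⟨ ∑-swap elems elems _ ⟩
    ∑ elems (λ y → ∑ elems (λ x → 𝟙 (y ≟ to x) * f y))
      ≡⟨ ∑-cong elems (λ y → ∑-cong elems (λ x → cong (_* f y)
          (𝟙-cong (λ y≡ → trans (sym (from∘to x)) (cong from (sym y≡)))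
                  (λ x≡ → trans (sym (to∘from y)) (cong to (sym x≡))) (y ≟ to x) (x ≟ from y)))) ⟩
    ∑ elems (λ y → ∑ elems (λ x → 𝟙 (x ≟ from y) * f y))
      ≡⟨ ∑-cong elems (λ y → ∑-δ (from y) (λ _ → f y)) ⟩
    ∑ elems f ∎
    where open ≡-Reasoning

  -- Adding `c` to both sides avoids subtraction: pointwise, `c` and `h x` trade places at `a`, and
  -- elsewhere they agree already.
  ∑-split : ∀ a (h : A → ℕ) c → (∀ x → x ≢ a → h x ≡ c) → ∑ elems h ≡ h a + (length elems ∸ 1) * c
  ∑-split a h c h≡c = +-cancelˡ-≡ c _ _ (begin
    c + ∑ elems h
      ≡⟨ cong (_+ ∑ elems h) (∑-δ a (λ _ → c)) ⟨
    ∑ elems (λ x → 𝟙 (x ≟ a) * c) + ∑ elems h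
      ≡⟨ ∑-+ elems _ h ⟨
    ∑ elems (λ x → 𝟙 (x ≟ a) * c + h x)
      ≡⟨ ∑-cong elems exchange ⟩
    ∑ elems (λ x → 𝟙 (x ≟ a) * h x + c)
      ≡⟨ ∑-+ elems _ _ ⟩
    ∑ elems (λ x → 𝟙 (x ≟ a) * h x) + ∑ elems (λ _ → c)
      ≡⟨ cong₂ _+_ (∑-δ a h) (∑-const elems c) ⟩
    h a + length elems * c
      ≡⟨ cong (λ l → h a + l * c) (sym (nonempty elems (complete a))) ⟩
    h a + (c + (length elems ∸ 1) * c)
      ≡⟨ +-assoc (h a) c _ ⟨
    (h a + c) + (length elems ∸ 1) * c
      ≡⟨ cong (_+ (length elems ∸ 1) * c) (+-comm (h a) c) ⟩
    (c + h a) + (length elems ∸ 1) * c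
      ≡⟨ +-assoc c (h a) _ ⟩
    c + (h a + (length elems ∸ 1) * c) ∎)
    where
    open ≡-Reasoning
    nonempty : ∀ (xs : List A) → a ∈ xs → suc (length xs ∸ 1) ≡ length xs
    nonempty (_ ∷ _) _ = refl
    exchange : ∀ x → 𝟙 (x ≟ a) * c + h x ≡ 𝟙 (x ≟ a) * h x + c
    exchange x with x ≟ a
    ... | yes _ = trans (cong (_+ h x) (*-identityˡ c)) (trans (+-comm c (h x)) (cong (_+ c) (sym (*-identityˡ (h x)))))
    ... | no x≢a = h≡c x x≢a

  search : ∀ {P : A → Set} → (∀ x → Dec (P x)) → Dec (∃ P)
  search {P} P? = map′ (λ s → let x , _ , px = find s in x , px) (λ (x , px) → lose (complete x) px) (any? P? elems)

  check : ∀ {P : A → Set} → (∀ x → Dec (P x)) → Dec (∀ x → P x)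
  check {P} P? with search (λ x → ¬? (P? x))
  ... | yes (x , ¬px) = no (λ h → ¬px (h x))
  ... | no ∄ = yes (λ x → decidable-stable (P? x) (λ ¬px → ∄ (x , ¬px)))

  ∑-pos : ∀ {f : A → ℕ} a → f a ≢ 0 → ∑ elems f ≢ 0
  ∑-pos {f} a fa≢0 = go elems (complete a)
    where
    go : ∀ xs → a ∈ xs → ∑ xs f ≢ 0
    go (x ∷ xs) (here refl) eq = fa≢0 (m+n≡0⇒m≡0 _ eq)
    go (x ∷ xs) (there a∈) eq = go xs a∈ (m+n≡0⇒n≡0 (f x) eq)

𝟙-× : (P → Q → PQ) → (PQ → P × Q) → (d : Dec P) (e : Dec Q) (r : Dec PQ) → 𝟙 r ≡ 𝟙 d * 𝟙 e
𝟙-× f g (yes a) (yes b) r = 𝟙-yes r (f a b)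
𝟙-× f g (yes _) (no ¬b) r = 𝟙-no r (¬b ∘ proj₂ ∘ g)
𝟙-× f g (no ¬a) e r = 𝟙-no r (¬a ∘ proj₁ ∘ g)

∑-δ-Fin : ∀ {n} (k : Fin n) (f : Fin n → ℕ) → ∑ (allFin n) (λ i → 𝟙 (i ≟F k) * f i) ≡ f k
∑-δ-Fin {n} k f = trans (cong sum (map-tabulate (λ i → i) (λ i → 𝟙 (i ≟F k) * f i))) (go k f)
  where
  zeros : ∀ {n} (h : Fin n → ℕ) → (∀ i → h i ≡ 0) → sum (tabulate h) ≡ 0
  zeros {zero} h h≡0 = refl
  zeros {suc n} h h≡0 = cong₂ _+_ (h≡0 Fin.zero) (zeros (h ∘ Fin.suc) (h≡0 ∘ Fin.suc))
  tabulate-sum-cong : ∀ {n} {g h : Fin n → ℕ} → g ≗ h → sum (tabulate g) ≡ sum (tabulate h)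
  tabulate-sum-cong {zero} e = refl
  tabulate-sum-cong {suc n} e = cong₂ _+_ (e Fin.zero) (tabulate-sum-cong (e ∘ Fin.suc))
  go : ∀ {n} (k : Fin n) (f : Fin n → ℕ) → sum (tabulate (λ i → 𝟙 (i ≟F k) * f i)) ≡ f k
  go Fin.zero f = trans (cong₂ _+_ (*-identityˡ (f Fin.zero)) (zeros (λ i → 𝟙 (Fin.suc i ≟F Fin.zero) * f (Fin.suc i)) (λ i → refl))) (+-identityʳ _)
  go (Fin.suc k) f = trans
    (tabulate-sum-cong (λ i → cong (_* f (Fin.suc i)) (𝟙-cong Fin-suc-injective (cong Fin.suc) (Fin.suc i ≟F Fin.suc k) (i ≟F k))))
    (go k (f ∘ Fin.suc))

-- Sums over vectors and the arithmetic of F^n.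

module VectorSpace {q : ℕ} (F : FiniteField q) (p : ℕ) .{{_ : NonZero p}} where
  open FiniteField F public renaming (_+ᶠ_ to infixl 6 _+ᶠ_; _*ᶠ_ to infixl 7 _*ᶠ_; -ᶠ_ to infix 8 -ᶠ_)
  open Geometry F p public renaming (_+ᵛ_ to infixl 6 _+ᵛ_; _·ᵛ_ to infixr 7 _·ᵛ_)

  ring : CommutativeRing 0ℓ 0ℓ
  ring = record { isCommutativeRing = isCommutativeRing }
  module R = CommutativeRing ring
  module RP = Algebra.Properties.Ring R.ring

  infix 4 _≟ᶠ_ _≟ᵛ_

  _≟ᶠ_ : DecidableEquality Carrier
  x ≟ᶠ y = map′ (Injection.injective (↔⇒↣ enum)) (cong (Inverse.to enum)) (Inverse.to enum x ≟F Inverse.to enum y)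

  _≟ᵛ_ : ∀ {n} → DecidableEquality (Vec Carrier n)
  _≟ᵛ_ = Vec.≡-dec _≟ᶠ_

  V : ℕ → Set
  V = Vec Carrier

  0ᵛ : ∀ {n} → V n
  0ᵛ = replicate _ 0ᶠ

  scalars : Listing Carrier
  scalars = record
    { elems = allElems
    ; _≟_ = _≟ᶠ_
    ; complete = λ a → subst (_∈ allElems) (Inverse.strictlyInverseʳ enum a) (∈-map⁺ (Inverse.from enum) (∈-allFin (Inverse.to enum a)))
    ; ∑-δ = δ
    }
    where
    δ : ∀ a (f : Carrier → ℕ) → ∑ allElems (λ x → 𝟙 (x ≟ᶠ a) * f x) ≡ f a
    δ a f = begin
      ∑ allElems (λ x → 𝟙 (x ≟ᶠ a) * f x)
        ≡⟨ ∑-map (Inverse.from enum) (allFin q) _ ⟩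
      ∑ (allFin q) (λ i → 𝟙 (Inverse.from enum i ≟ᶠ a) * f (Inverse.from enum i))
        ≡⟨ ∑-cong (allFin q) (λ i → cong (_* f (Inverse.from enum i))
             (𝟙-cong (λ e → trans (sym (Inverse.strictlyInverseˡ enum i)) (cong (Inverse.to enum) e))
                     (λ e → trans (cong (Inverse.from enum) e) (Inverse.strictlyInverseʳ enum a))
                     (Inverse.from enum i ≟ᶠ a) (i ≟F Inverse.to enum a))) ⟩
      ∑ (allFin q) (λ i → 𝟙 (i ≟F Inverse.to enum a) * f (Inverse.from enum i))
        ≡⟨ ∑-δ-Fin (Inverse.to enum a) (f ∘ Inverse.from enum) ⟩
      f (Inverse.from enum (Inverse.to enum a))
        ≡⟨ cong f (Inverse.strictlyInverseʳ enum a) ⟩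
      f a ∎
      where open ≡-Reasoning

  ∑F : (Carrier → ℕ) → ℕ
  ∑F = ∑ allElems

  ∑V : ∀ n → (V n → ℕ) → ℕ
  ∑V n = ∑ (allVecs n)

  ∑V-suc : ∀ n f → ∑V (suc n) f ≡ ∑F (λ x → ∑V n (λ v → f (x ∷ v)))
  ∑V-suc n f = trans (∑-concatMap (λ x → map (x ∷_) (allVecs n)) allElems f)
    (∑-cong allElems (λ x → ∑-map (x ∷_) (allVecs n) f))

  vectors : ∀ n → Listing (V n)
  vectors n = record { elems = allVecs n ; _≟_ = _≟ᵛ_ ; complete = complete ; ∑-δ = δ }
    where
    complete : ∀ {n} (v : V n) → v ∈ allVecs n
    complete [] = here refl
    complete {suc n} (x ∷ v) = ∈-concatMap⁺ (λ x → map (x ∷_) (allVecs n)) {xs = allElems}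
      (lose (Listing.complete scalars x) (∈-map⁺ (x ∷_) (complete v)))
    δ : ∀ {n} a (f : V n → ℕ) → ∑V n (λ x → 𝟙 (x ≟ᵛ a) * f x) ≡ f a
    δ [] f = trans (+-identityʳ _) (*-identityˡ (f []))
    δ {suc n} (a ∷ b) f = begin
      ∑V (suc n) (λ x → 𝟙 (x ≟ᵛ (a ∷ b)) * f x)
        ≡⟨ ∑V-suc n _ ⟩
      ∑F (λ x → ∑V n (λ v → 𝟙 ((x ∷ v) ≟ᵛ (a ∷ b)) * f (x ∷ v)))
        ≡⟨ ∑-cong allElems (λ x → trans (∑-cong (allVecs n) (λ v → trans
             (cong (_* f (x ∷ v)) (𝟙-× (cong₂ _∷_) Vec.∷-injective (x ≟ᶠ a) (v ≟ᵛ b) ((x ∷ v) ≟ᵛ (a ∷ b))))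
             (*-assoc (𝟙 (x ≟ᶠ a)) _ _)))
             (∑-*ˡ (allVecs n) (𝟙 (x ≟ᶠ a)) _)) ⟩
      ∑F (λ x → 𝟙 (x ≟ᶠ a) * ∑V n (λ v → 𝟙 (v ≟ᵛ b) * f (x ∷ v)))
        ≡⟨ ∑-cong allElems (λ x → cong (𝟙 (x ≟ᶠ a) *_) (δ b (λ v → f (x ∷ v)))) ⟩
      ∑F (λ x → 𝟙 (x ≟ᶠ a) * f (x ∷ b))
        ≡⟨ Listing.∑-δ scalars a _ ⟩
      f (a ∷ b) ∎
      where open ≡-Reasoning

  module 𝔽 = Listing scalars
  module 𝕍 {n} = Listing (vectors n)

  length-allElems : length allElems ≡ q
  length-allElems = trans (length-map (Inverse.from enum) (allFin q)) (length-tabulate (λ i → i))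

  ∑F-const : ∀ a → ∑F (λ _ → a) ≡ q * a
  ∑F-const a = trans (∑-const allElems a) (cong (_* a) length-allElems)

  ∑V-const : ∀ n a → ∑V n (λ _ → a) ≡ q ^ n * a
  ∑V-const zero a = refl
  ∑V-const (suc n) a = begin
    ∑V (suc n) (λ _ → a) ≡⟨ ∑V-suc n _ ⟩
    ∑F (λ _ → ∑V n (λ _ → a)) ≡⟨ ∑F-const _ ⟩
    q * ∑V n (λ _ → a) ≡⟨ cong (q *_) (∑V-const n a) ⟩
    q * (q ^ n * a) ≡⟨ *-assoc q _ a ⟨
    q ^ suc n * a ∎
    where open ≡-Reasoning

  ∑F-split : ∀ (h : Carrier → ℕ) c → (∀ x → x ≢ 0ᶠ → h x ≡ c) → ∑F h ≡ h 0ᶠ + (q ∸ 1) * c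
  ∑F-split h c e = trans (𝔽.∑-split 0ᶠ h c e) (cong (λ l → h 0ᶠ + (l ∸ 1) * c) length-allElems)

  inv : ∀ {a} → a ≢ 0ᶠ → Carrier
  inv {a} a≢0 = proj₁ (inverse a a≢0)

  inv-right : ∀ {a} (a≢0 : a ≢ 0ᶠ) → a *ᶠ inv a≢0 ≡ 1ᶠ
  inv-right {a} a≢0 = proj₂ (inverse a a≢0)

  inv-left : ∀ {a} (a≢0 : a ≢ 0ᶠ) → inv a≢0 *ᶠ a ≡ 1ᶠ
  inv-left a≢0 = trans (R.*-comm _ _) (inv-right a≢0)

  cancel-inv : ∀ {a} (a≢0 : a ≢ 0ᶠ) x → a *ᶠ (inv a≢0 *ᶠ x) ≡ x
  cancel-inv a≢0 x = trans (sym (R.*-assoc _ _ _)) (trans (cong (_*ᶠ x) (inv-right a≢0)) (R.*-identityˡ x))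

  cancel-inv′ : ∀ {a} (a≢0 : a ≢ 0ᶠ) x → inv a≢0 *ᶠ (a *ᶠ x) ≡ x
  cancel-inv′ a≢0 x = trans (sym (R.*-assoc _ _ _)) (trans (cong (_*ᶠ x) (inv-left a≢0)) (R.*-identityˡ x))

  a*x≡0⇒x≡0 : ∀ {a x} → a ≢ 0ᶠ → a *ᶠ x ≡ 0ᶠ → x ≡ 0ᶠ
  a*x≡0⇒x≡0 a≢0 e = trans (sym (cancel-inv′ a≢0 _)) (trans (cong (inv a≢0 *ᶠ_) e) (R.zeroʳ _))

  +ᵛ-assoc : ∀ {n} (u v w : V n) → (u +ᵛ v) +ᵛ w ≡ u +ᵛ (v +ᵛ w)
  +ᵛ-assoc = Vec.zipWith-assoc R.+-assoc

  +ᵛ-comm : ∀ {n} (u v : V n) → u +ᵛ v ≡ v +ᵛ u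
  +ᵛ-comm = Vec.zipWith-comm R.+-comm

  +ᵛ-identityˡ : ∀ {n} (v : V n) → 0ᵛ +ᵛ v ≡ v
  +ᵛ-identityˡ = Vec.zipWith-identityˡ R.+-identityˡ

  +ᵛ-identityʳ : ∀ {n} (v : V n) → v +ᵛ 0ᵛ ≡ v
  +ᵛ-identityʳ = Vec.zipWith-identityʳ R.+-identityʳ

  ·ᵛ-distribˡ : ∀ {n} a (u v : V n) → a ·ᵛ (u +ᵛ v) ≡ a ·ᵛ u +ᵛ a ·ᵛ v
  ·ᵛ-distribˡ a [] [] = refl
  ·ᵛ-distribˡ a (x ∷ u) (y ∷ v) = cong₂ _∷_ (R.distribˡ a x y) (·ᵛ-distribˡ a u v)

  ·ᵛ-distribʳ : ∀ {n} a b (v : V n) → (a +ᶠ b) ·ᵛ v ≡ a ·ᵛ v +ᵛ b ·ᵛ v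
  ·ᵛ-distribʳ a b [] = refl
  ·ᵛ-distribʳ a b (x ∷ v) = cong₂ _∷_ (R.distribʳ x a b) (·ᵛ-distribʳ a b v)

  ·ᵛ-assoc : ∀ {n} a b (v : V n) → (a *ᶠ b) ·ᵛ v ≡ a ·ᵛ b ·ᵛ v
  ·ᵛ-assoc a b [] = refl
  ·ᵛ-assoc a b (x ∷ v) = cong₂ _∷_ (R.*-assoc a b x) (·ᵛ-assoc a b v)

  ·ᵛ-comm : ∀ {n} a b (v : V n) → a ·ᵛ b ·ᵛ v ≡ b ·ᵛ a ·ᵛ v
  ·ᵛ-comm a b v = trans (sym (·ᵛ-assoc a b v)) (trans (cong (_·ᵛ v) (R.*-comm a b)) (·ᵛ-assoc b a v))

  1·ᵛ : ∀ {n} (v : V n) → 1ᶠ ·ᵛ v ≡ v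
  1·ᵛ [] = refl
  1·ᵛ (x ∷ v) = cong₂ _∷_ (R.*-identityˡ x) (1·ᵛ v)

  0·ᵛ : ∀ {n} (v : V n) → 0ᶠ ·ᵛ v ≡ 0ᵛ
  0·ᵛ [] = refl
  0·ᵛ (x ∷ v) = cong₂ _∷_ (R.zeroˡ x) (0·ᵛ v)

  ·ᵛ-zero : ∀ {n} a → a ·ᵛ 0ᵛ {n} ≡ 0ᵛ
  ·ᵛ-zero {zero} a = refl
  ·ᵛ-zero {suc n} a = cong₂ _∷_ (R.zeroʳ a) (·ᵛ-zero a)

  +ᵛ-interchange : ∀ {n} (a b c d : V n) → (a +ᵛ b) +ᵛ (c +ᵛ d) ≡ (a +ᵛ c) +ᵛ (b +ᵛ d)
  +ᵛ-interchange a b c d = begin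
    (a +ᵛ b) +ᵛ (c +ᵛ d) ≡⟨ +ᵛ-assoc a b _ ⟩
    a +ᵛ (b +ᵛ (c +ᵛ d)) ≡⟨ cong (a +ᵛ_) (+ᵛ-assoc b c d) ⟨
    a +ᵛ ((b +ᵛ c) +ᵛ d) ≡⟨ cong (λ z → a +ᵛ (z +ᵛ d)) (+ᵛ-comm b c) ⟩
    a +ᵛ ((c +ᵛ b) +ᵛ d) ≡⟨ cong (a +ᵛ_) (+ᵛ-assoc c b d) ⟩
    a +ᵛ (c +ᵛ (b +ᵛ d)) ≡⟨ +ᵛ-assoc a c _ ⟨
    (a +ᵛ c) +ᵛ (b +ᵛ d) ∎
    where open ≡-Reasoning

  u-u : ∀ {n} s (u : V n) → s ·ᵛ u +ᵛ (-ᶠ s) ·ᵛ u ≡ 0ᵛ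
  u-u s u = trans (sym (·ᵛ-distribʳ s (-ᶠ s) u)) (trans (cong (_·ᵛ u) (R.-‿inverseʳ s)) (0·ᵛ u))

  -u+u : ∀ {n} s (u : V n) → (-ᶠ s) ·ᵛ u +ᵛ s ·ᵛ u ≡ 0ᵛ
  -u+u s u = trans (+ᵛ-comm _ _) (u-u s u)

  scale-cancel : ∀ {n a} (a≢0 : a ≢ 0ᶠ) (v : V n) → a ·ᵛ inv a≢0 ·ᵛ v ≡ v
  scale-cancel a≢0 v = trans (sym (·ᵛ-assoc _ _ v)) (trans (cong (_·ᵛ v) (inv-right a≢0)) (1·ᵛ v))

  scale-cancel′ : ∀ {n a} (a≢0 : a ≢ 0ᶠ) (v : V n) → inv a≢0 ·ᵛ a ·ᵛ v ≡ v
  scale-cancel′ a≢0 v = trans (sym (·ᵛ-assoc _ _ v)) (trans (cong (_·ᵛ v) (inv-left a≢0)) (1·ᵛ v))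

  ∑V-scale : ∀ {n a} → a ≢ 0ᶠ → (f : V n → ℕ) → ∑V n (λ v → f (a ·ᵛ v)) ≡ ∑V n f
  ∑V-scale {a = a} a≢0 f = 𝕍.∑-reindex (a ·ᵛ_) (inv a≢0 ·ᵛ_) (scale-cancel′ a≢0) (scale-cancel a≢0) f

  ∑V-translate : ∀ {n} s (u : V n) (f : V n → ℕ) → ∑V n (λ v → f (s ·ᵛ u +ᵛ v)) ≡ ∑V n f
  ∑V-translate s u f = 𝕍.∑-reindex (s ·ᵛ u +ᵛ_) ((-ᶠ s) ·ᵛ u +ᵛ_)
    (λ v → trans (sym (+ᵛ-assoc _ _ v)) (trans (cong (_+ᵛ v) (-u+u s u)) (+ᵛ-identityˡ v)))
    (λ v → trans (sym (+ᵛ-assoc _ _ v)) (trans (cong (_+ᵛ v) (u-u s u)) (+ᵛ-identityˡ v))) f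

  -- Linear maps and complements of a line.

  record Linear {m n : ℕ} (L : V m → V n) : Set where
    constructor linear
    field
      additive : ∀ u v → L (u +ᵛ v) ≡ L u +ᵛ L v
      homogeneous : ∀ a v → L (a ·ᵛ v) ≡ a ·ᵛ L v

    preserves-0 : L 0ᵛ ≡ 0ᵛ
    preserves-0 = trans (cong L (sym (0·ᵛ 0ᵛ))) (trans (homogeneous 0ᶠ 0ᵛ) (0·ᵛ _))
  open Linear

  linear-∘ : ∀ {l m n} {L : V m → V n} {K : V l → V m} → Linear L → Linear K → Linear (L ∘ K)
  linear-∘ {L = L} {K} lL lK = linear
    (λ u v → trans (cong L (additive lK u v)) (additive lL _ _))
    (λ a v → trans (cong L (homogeneous lK a v)) (homogeneous lL a _))

  linear-tail : ∀ {n} → Linear (Vec.tail {n = n})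
  linear-tail = linear (λ { (_ ∷ _) (_ ∷ _) → refl }) (λ { _ (_ ∷ _) → refl })

  linear-0∷ : ∀ {n} → Linear {n} (0ᶠ ∷_)
  linear-0∷ = linear (λ u v → cong (_∷ (u +ᵛ v)) (sym (R.+-identityˡ 0ᶠ))) (λ a v → cong (_∷ (a ·ᵛ v)) (sym (R.zeroʳ a)))

  linComb-linear : ∀ {m n} (b : Vec (V n) m) → Linear (λ a → linComb a b)
  linComb-linear b = linear (add b) (hom b)
    where
    add : ∀ {m n} (b : Vec (V n) m) (u v : V m) → linComb (u +ᵛ v) b ≡ linComb u b +ᵛ linComb v b
    add [] [] [] = sym (+ᵛ-identityˡ _)
    add (b ∷ bs) (x ∷ u) (y ∷ v) = trans (cong₂ _+ᵛ_ (·ᵛ-distribʳ x y b) (add bs u v)) (+ᵛ-interchange _ _ _ _)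
    hom : ∀ {m n} (b : Vec (V n) m) a (v : V m) → linComb (a ·ᵛ v) b ≡ a ·ᵛ linComb v b
    hom [] a [] = sym (·ᵛ-zero a)
    hom (b ∷ bs) a (x ∷ v) = trans (cong₂ _+ᵛ_ (·ᵛ-assoc a x b) (hom bs a v)) (sym (·ᵛ-distribˡ a _ _))

  columns : ∀ {m n} → (V m → V n) → Vec (V n) m
  columns {zero} L = []
  columns {suc m} L = L (1ᶠ ∷ 0ᵛ) ∷ columns (λ v → L (0ᶠ ∷ v))

  linComb-columns : ∀ {m n} {L : V m → V n} → Linear L → ∀ v → linComb v (columns L) ≡ L v
  linComb-columns lL [] = sym (preserves-0 lL)
  linComb-columns {L = L} lL (x ∷ v) = begin
    x ·ᵛ L (1ᶠ ∷ 0ᵛ) +ᵛ linComb v (columns (λ v → L (0ᶠ ∷ v)))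
      ≡⟨ cong₂ _+ᵛ_ (sym (homogeneous lL x _)) (linComb-columns (linear-∘ lL linear-0∷) v) ⟩
    L (x ·ᵛ (1ᶠ ∷ 0ᵛ)) +ᵛ L (0ᶠ ∷ v)
      ≡⟨ additive lL _ _ ⟨
    L ((x *ᶠ 1ᶠ +ᶠ 0ᶠ) ∷ (x ·ᵛ 0ᵛ +ᵛ v))
      ≡⟨ cong L (cong₂ _∷_ (trans (R.+-identityʳ _) (R.*-identityʳ x)) (trans (cong (_+ᵛ v) (·ᵛ-zero x)) (+ᵛ-identityˡ v))) ⟩
    L (x ∷ v) ∎
    where open ≡-Reasoning

  -- The image of `σ` is a complement of the line spanned by `u`, so `w` indexes the cosets of that
  -- line and `s` runs along one coset. Projectively, `σ` followed over all `s` describes the lines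
  -- through the point `u`.
  record Complement {n : ℕ} (u : V (suc n)) : Set where
    field
      σ : V n → V (suc n)
      σ-linear : Linear σ
      ∑-decompose : ∀ G → ∑V (suc n) G ≡ ∑V n (λ w → ∑F (λ s → G (s ·ᵛ u +ᵛ σ w)))
      decompose : ∀ v → ∃[ s ] ∃[ w ] v ≡ s ·ᵛ u +ᵛ σ w

  -- The complement consists of the vectors that vanish at the position of the first nonzero entry
  -- of `u`. Leading zeros of `u` are passed over by recursion.
  complement : ∀ {n} (u : V (suc n)) → u ≢ 0ᵛ → Complement u
  complement {n} (r ∷ u) u≢0 with r ≟ᶠ 0ᶠ
  complement {zero} (r ∷ []) u≢0 | yes refl = contradiction refl u≢0
  complement {suc n} (r ∷ u) u≢0 | yes refl = record
    { σ = λ { (x ∷ w) → x ∷ σ w }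
    ; σ-linear = linear
        (λ { (x ∷ v) (y ∷ w) → cong ((x +ᶠ y) ∷_) (additive σ-linear v w) })
        (λ { a (x ∷ w) → cong ((a *ᶠ x) ∷_) (homogeneous σ-linear a w) })
    ; ∑-decompose = λ G → begin
        ∑V (suc (suc n)) G
          ≡⟨ ∑V-suc (suc n) G ⟩
        ∑F (λ x → ∑V (suc n) (λ v → G (x ∷ v)))
          ≡⟨ ∑-cong allElems (λ x → ∑-decompose (λ v → G (x ∷ v))) ⟩
        ∑F (λ x → ∑V n (λ w → ∑F (λ s → G (x ∷ (s ·ᵛ u +ᵛ σ w)))))
          ≡⟨ ∑-cong allElems (λ x → ∑-cong (allVecs n) (λ w → ∑-cong allElems (λ s →
               cong (λ z → G (z ∷ (s ·ᵛ u +ᵛ σ w))) (sym (s0+x s x))))) ⟩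
        ∑F (λ x → ∑V n (λ w → ∑F (λ s → G ((s *ᶠ 0ᶠ +ᶠ x) ∷ (s ·ᵛ u +ᵛ σ w)))))
          ≡⟨ ∑V-suc n _ ⟨
        _ ∎
    ; decompose = λ { (x ∷ v) → let s , w , v≡ = decompose v in
        s , x ∷ w , cong₂ _∷_ (sym (s0+x s x)) v≡ }
    }
    where
    open ≡-Reasoning
    open Complement (complement u (λ u≡0 → u≢0 (cong (0ᶠ ∷_) u≡0)))
    s0+x : ∀ s x → s *ᶠ 0ᶠ +ᶠ x ≡ x
    s0+x s x = trans (cong (_+ᶠ x) (R.zeroʳ s)) (R.+-identityˡ x)
  complement {n} (r ∷ u) u≢0 | no r≢0 = record
    { σ = 0ᶠ ∷_
    ; σ-linear = linear-0∷
    ; ∑-decompose = λ G → sym (begin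
        ∑V n (λ w → ∑F (λ s → G ((s *ᶠ r +ᶠ 0ᶠ) ∷ (s ·ᵛ u +ᵛ w))))
          ≡⟨ ∑-swap (allVecs n) allElems _ ⟩
        ∑F (λ s → ∑V n (λ w → G ((s *ᶠ r +ᶠ 0ᶠ) ∷ (s ·ᵛ u +ᵛ w))))
          -- For fixed `s` the summand `s ·ᵛ u` in the tail is absorbed by translating `w`;
          -- afterwards `s` is rescaled by the pivot `r`.
          ≡⟨ ∑-cong allElems (λ s → trans (∑V-translate s u _)
               (∑-cong (allVecs n) (λ w → cong (λ z → G (z ∷ w)) (sr s)))) ⟩
        ∑F (λ s → ∑V n (λ w → G ((r *ᶠ s) ∷ w)))
          ≡⟨ 𝔽.∑-reindex (r *ᶠ_) (inv r≢0 *ᶠ_) (cancel-inv′ r≢0) (cancel-inv r≢0) _ ⟩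
        ∑F (λ x → ∑V n (λ w → G (x ∷ w)))
          ≡⟨ ∑V-suc n G ⟨
        ∑V (suc n) G ∎)
    ; decompose = λ { (x ∷ v) → let s = inv r≢0 *ᶠ x in
        s , (-ᶠ s) ·ᵛ u +ᵛ v ,
        cong₂ _∷_ (sym (trans (sr s) (cancel-inv r≢0 x)))
          (sym (trans (sym (+ᵛ-assoc _ _ v)) (trans (cong (_+ᵛ v) (u-u s u)) (+ᵛ-identityˡ v)))) }
    }
    where
    open ≡-Reasoning
    sr : ∀ s → s *ᶠ r +ᶠ 0ᶠ ≡ r *ᶠ s
    sr s = trans (R.+-identityʳ _) (R.*-comm s r)

-- Functions on F^n whose sums over subspaces vanish modulo p.

module DualFunctions {q : ℕ} (F : FiniteField q) (p : ℕ) .{{_ : NonZero p}} (1<p : 1 < p) (p∣q : p ∣ q) where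
  open VectorSpace F p
  open Linear

  suc-pred-q : suc (q ∸ 1) ≡ q
  suc-pred-q = subst (λ l → suc (l ∸ 1) ≡ l) length-allElems (nonempty (𝔽.complete 0ᶠ))
    where
    nonempty : ∀ {xs : List Carrier} → Any (0ᶠ ≡_) xs → suc (length xs ∸ 1) ≡ length xs
    nonempty (here _) = refl
    nonempty (there _) = refl

  instance
    q-nonZero : NonZero q
    q-nonZero = subst NonZero suc-pred-q _

  -- Modulo p the factor q - 1 is -1: adding `m` to the multiple gives `q * m`, which p divides.
  p∣pred*⇒p∣ : ∀ m → p ∣ (q ∸ 1) * m → p ∣ m
  p∣pred*⇒p∣ m h = ∣m+n∣m⇒∣n (subst (p ∣_) (+-comm m _) (subst (λ k → p ∣ k * m) (sym suc-pred-q) (∣m⇒∣m*n m p∣q))) h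

  -- `j` is a vector dimension, one more than the projective dimension of the subspaces concerned.
  Annihilates : ∀ {n} → ℕ → (V n → ℕ) → Set
  Annihilates {n} j f = ∀ (b : Vec (V n) j) → p ∣ ∑V j (λ a → f (linComb a b))

  -- Invariance is an exact equality in ℕ, so that sums over vectors convert into sums over points
  -- before any reduction; the other two conditions are congruences modulo p.
  record DualFunction (n j : ℕ) (f : V n → ℕ) : Set where
    constructor dualFunction
    field
      invariant : ∀ a v → a ≢ 0ᶠ → f (a ·ᵛ v) ≡ f v
      vanish : p ∣ f 0ᵛ
      annihilates : Annihilates j f

  -- Every linear map is `linComb` with its own `columns`, so the tuples in `Annihilates` account
  -- for all linear maps, injective or not.
  annihilates-linear : ∀ {n j} f → Annihilates {n} j f → ∀ {L : V j → V n} → Linear L → p ∣ ∑V j (f ∘ L)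
  annihilates-linear {j = j} f ann {L} lL =
    subst (p ∣_) (∑-cong (allVecs j) (λ v → cong f (linComb-columns lL v))) (ann (columns L))

  linComb-map : ∀ {m n k} {L : V n → V k} → Linear L → (a : V m) (b : Vec (V n) m) →
    linComb a (Vec.map L b) ≡ L (linComb a b)
  linComb-map lL [] [] = sym (preserves-0 lL)
  linComb-map lL (x ∷ a) (v ∷ b) = trans (cong₂ _+ᵛ_ (sym (homogeneous lL x v)) (linComb-map lL a b)) (sym (additive lL _ _))

  head-+ᵛ : ∀ {n} (u v : V (suc n)) → head (u +ᵛ v) ≡ head u +ᶠ head v
  head-+ᵛ (_ ∷ _) (_ ∷ _) = refl

  head-·ᵛ : ∀ {n} a (v : V (suc n)) → head (a ·ᵛ v) ≡ a *ᶠ head v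
  head-·ᵛ a (_ ∷ _) = refl

  -- The first coordinate of `L` is a linear functional. If it is nonzero at some `u`, each coset of
  -- the line of `u` has exactly one zero of it, and `τ` picks this zero, parametrizing the kernel
  -- by F^j.
  ∑-kernel : ∀ {j n} {L : V (suc j) → V (suc n)} → Linear L →
    (∀ v → head (L v) ≡ 0ᶠ) ⊎
    ∃[ τ ] Linear τ × (∀ H → ∑V (suc j) (λ v → 𝟙 (head (L v) ≟ᶠ 0ᶠ) * H v) ≡ ∑V j (H ∘ τ))
  ∑-kernel {j} {n} {L} lL with 𝕍.search (λ u → ¬? (head (L u) ≟ᶠ 0ᶠ))
  ... | no ∄ = inj₁ (λ v → decidable-stable (head (L v) ≟ᶠ 0ᶠ) (λ ≢0 → ∄ (v , ≢0)))
  ... | yes (u , c≢0) = inj₂ (τ , linear τ-additive τ-homogeneous , sums)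
    where
    u≢0 : u ≢ 0ᵛ
    u≢0 refl = c≢0 (cong head (preserves-0 lL))
    open Complement (complement u u≢0)
    open ≡-Reasoning
    φ : V (suc j) → Carrier
    φ v = head (L v)
    c = φ u
    d = inv c≢0
    φ-+ : ∀ x y → φ (x +ᵛ y) ≡ φ x +ᶠ φ y
    φ-+ x y = trans (cong head (additive lL x y)) (head-+ᵛ (L x) (L y))
    φ-· : ∀ a x → φ (a ·ᵛ x) ≡ a *ᶠ φ x
    φ-· a x = trans (cong head (homogeneous lL a x)) (head-·ᵛ a (L x))
    κ : V j → Carrier
    -- The solution `s` of the equation `s *ᶠ c +ᶠ φ (σ w) ≡ 0ᶠ`.
    κ w = (-ᶠ d) *ᶠ φ (σ w)
    κ-+ : ∀ v w → κ (v +ᵛ w) ≡ κ v +ᶠ κ w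
    κ-+ v w = trans (cong (λ z → (-ᶠ d) *ᶠ z) (trans (cong φ (additive σ-linear v w)) (φ-+ _ _))) (R.distribˡ _ _ _)
    κ-· : ∀ a w → κ (a ·ᵛ w) ≡ a *ᶠ κ w
    κ-· a w = begin
      (-ᶠ d) *ᶠ φ (σ (a ·ᵛ w)) ≡⟨ cong (λ z → (-ᶠ d) *ᶠ z) (trans (cong φ (homogeneous σ-linear a w)) (φ-· _ _)) ⟩
      (-ᶠ d) *ᶠ (a *ᶠ φ (σ w)) ≡⟨ R.*-assoc _ _ _ ⟨
      ((-ᶠ d) *ᶠ a) *ᶠ φ (σ w) ≡⟨ cong (_*ᶠ φ (σ w)) (R.*-comm _ a) ⟩
      (a *ᶠ (-ᶠ d)) *ᶠ φ (σ w) ≡⟨ R.*-assoc _ _ _ ⟩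
      a *ᶠ κ w ∎
    τ : V j → V (suc j)
    τ w = κ w ·ᵛ u +ᵛ σ w
    τ-additive : ∀ v w → τ (v +ᵛ w) ≡ τ v +ᵛ τ w
    τ-additive v w = trans (cong₂ _+ᵛ_ (trans (cong (_·ᵛ u) (κ-+ v w)) (·ᵛ-distribʳ _ _ u)) (additive σ-linear v w))
      (+ᵛ-interchange _ _ _ _)
    τ-homogeneous : ∀ a w → τ (a ·ᵛ w) ≡ a ·ᵛ τ w
    τ-homogeneous a w = trans (cong₂ _+ᵛ_ (trans (cong (_·ᵛ u) (κ-· a w)) (·ᵛ-assoc _ _ u)) (homogeneous σ-linear a w))
      (sym (·ᵛ-distribˡ a _ _))
    φ-line : ∀ s w → φ (s ·ᵛ u +ᵛ σ w) ≡ s *ᶠ c +ᶠ φ (σ w)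
    φ-line s w = trans (φ-+ _ _) (cong (_+ᶠ φ (σ w)) (φ-· s u))
    -d : ∀ y → (-ᶠ d) *ᶠ y ≡ d *ᶠ (-ᶠ y)
    -d y = trans (sym (RP.-‿distribˡ-* d y)) (RP.-‿distribʳ-* d y)
    solve⇒ : ∀ s w → φ (s ·ᵛ u +ᵛ σ w) ≡ 0ᶠ → s ≡ κ w
    solve⇒ s w e = begin
      s ≡⟨ cancel-inv′ c≢0 s ⟨
      d *ᶠ (c *ᶠ s) ≡⟨ cong (d *ᶠ_) (R.*-comm c s) ⟩
      d *ᶠ (s *ᶠ c) ≡⟨ cong (d *ᶠ_) (RP.+-inverseˡ-unique _ _ (trans (sym (φ-line s w)) e)) ⟩
      d *ᶠ (-ᶠ φ (σ w)) ≡⟨ -d _ ⟨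
      κ w ∎
    solve⇐ : ∀ s w → s ≡ κ w → φ (s ·ᵛ u +ᵛ σ w) ≡ 0ᶠ
    solve⇐ s w refl = begin
      φ (κ w ·ᵛ u +ᵛ σ w) ≡⟨ φ-line (κ w) w ⟩
      κ w *ᶠ c +ᶠ φ (σ w) ≡⟨ cong (_+ᶠ φ (σ w)) (trans (R.*-comm _ c) (trans (cong (c *ᶠ_) (-d _)) (cancel-inv c≢0 _))) ⟩
      (-ᶠ φ (σ w)) +ᶠ φ (σ w) ≡⟨ R.-‿inverseˡ _ ⟩
      0ᶠ ∎
    sums : ∀ H → ∑V (suc j) (λ v → 𝟙 (φ v ≟ᶠ 0ᶠ) * H v) ≡ ∑V j (H ∘ τ)
    sums H = begin
      ∑V (suc j) (λ v → 𝟙 (φ v ≟ᶠ 0ᶠ) * H v)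
        ≡⟨ ∑-decompose _ ⟩
      ∑V j (λ w → ∑F (λ s → 𝟙 (φ (s ·ᵛ u +ᵛ σ w) ≟ᶠ 0ᶠ) * H (s ·ᵛ u +ᵛ σ w)))
        ≡⟨ ∑-cong (allVecs j) (λ w → ∑-cong allElems (λ s → cong (_* H (s ·ᵛ u +ᵛ σ w))
             (𝟙-cong (solve⇒ s w) (solve⇐ s w) (φ (s ·ᵛ u +ᵛ σ w) ≟ᶠ 0ᶠ) (s ≟ᶠ κ w)))) ⟩
      ∑V j (λ w → ∑F (λ s → 𝟙 (s ≟ᶠ κ w) * H (s ·ᵛ u +ᵛ σ w)))
        ≡⟨ ∑-cong (allVecs j) (λ w → 𝔽.∑-δ (κ w) (λ s → H (s ·ᵛ u +ᵛ σ w))) ⟩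
      ∑V j (H ∘ τ) ∎

  -- Raising the dimension: extension by zero from a hyperplane.

  extend : ∀ {n} → (V n → ℕ) → V (suc n) → ℕ
  extend f v = 𝟙 (head v ≟ᶠ 0ᶠ) * f (tail v)

  -- An image of F^(j+1) either lies in the hyperplane, where order `suc j` of `f` applies, or meets
  -- it in an image of F^j, where order `j` applies. Hence both orders are assumed.
  extend-annihilates : ∀ {n j} (f : V n → ℕ) → Annihilates j f → Annihilates (suc j) f → Annihilates (suc j) (extend f)
  extend-annihilates {j = j} f annⱼ annₛ b with ∑-kernel (linComb-linear b)
  ... | inj₁ head≡0 = subst (p ∣_)
        (∑-cong (allVecs (suc j)) (λ v → sym (trans
          (cong (_* f (tail (linComb v b))) (𝟙-yes (head (linComb v b) ≟ᶠ 0ᶠ) (head≡0 v))) (*-identityˡ _))))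
        (annihilates-linear f annₛ (linear-∘ linear-tail (linComb-linear b)))
  ... | inj₂ (τ , lτ , sums) = subst (p ∣_) (sym (sums _))
        (annihilates-linear f annⱼ (linear-∘ linear-tail (linear-∘ (linComb-linear b) lτ)))

  -- Sum over the planes spanned by b₀ and linComb v bs, where s and t are
  -- the coordinates on such a plane. The terms with t = 0 are multiples
  -- of p; every other t contributes the full sum, so q - 1 ≡ -1 times the full sum vanishes mod p.
  annihilates-spread : ∀ {n} (f : V n → ℕ) → Annihilates 2 f → ∀ i → Annihilates (2 + i) f
  annihilates-spread {n} f ann i (b₀ ∷ bs) =
    p∣pred*⇒p∣ _ (∣m+n∣m⇒∣n (subst (p ∣_) planes (∑-∣ (allVecs (suc i)) λ v → ann (b₀ ∷ linComb v bs ∷ [])))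
      (∑-∣ allElems λ s → subst (p ∣_) (sym (trans (∑-cong (allVecs (suc i)) λ v → cong (λ z → f (s ·ᵛ b₀ +ᵛ linComb z bs)) (0·ᵛ v)) (∑V-const (suc i) _)))
        (∣m⇒∣m*n _ (∣m⇒∣m*n (q ^ i) p∣q))))
    where
    open ≡-Reasoning
    g : Carrier → V (suc i) → ℕ
    g s v = f (s ·ᵛ b₀ +ᵛ linComb v bs)
    planes : ∑V (suc i) (λ v → ∑V 2 (λ a → f (linComb a (b₀ ∷ linComb v bs ∷ [])))) ≡
      ∑F (λ s → ∑V (suc i) (λ v → g s (0ᶠ ·ᵛ v))) + (q ∸ 1) * ∑V (2 + i) (λ a → f (linComb a (b₀ ∷ bs)))
    planes = begin
      ∑V (suc i) (λ v → ∑V 2 (λ a → f (linComb a (b₀ ∷ linComb v bs ∷ []))))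
        ≡⟨ ∑-cong (allVecs (suc i)) (λ v → trans (∑V-suc 1 _) (∑-cong allElems λ s → trans (∑V-suc 0 _)
             (∑-cong allElems λ t → trans (+-identityʳ _) (cong (λ z → f (s ·ᵛ b₀ +ᵛ z))
               (trans (+ᵛ-identityʳ _) (sym (homogeneous (linComb-linear bs) t v))))))) ⟩
      ∑V (suc i) (λ v → ∑F (λ s → ∑F (λ t → g s (t ·ᵛ v))))
        ≡⟨ ∑-swap (allVecs (suc i)) allElems _ ⟩
      ∑F (λ s → ∑V (suc i) (λ v → ∑F (λ t → g s (t ·ᵛ v))))
        ≡⟨ ∑-cong allElems (λ s → ∑-swap (allVecs (suc i)) allElems _) ⟩
      ∑F (λ s → ∑F (λ t → ∑V (suc i) (λ v → g s (t ·ᵛ v))))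
        ≡⟨ ∑-cong allElems (λ s → ∑F-split _ _ λ t t≢0 → ∑V-scale t≢0 (g s)) ⟩
      ∑F (λ s → ∑V (suc i) (λ v → g s (0ᶠ ·ᵛ v)) + (q ∸ 1) * ∑V (suc i) (g s))
        ≡⟨ trans (∑-+ allElems _ _) (cong (∑F (λ s → ∑V (suc i) (λ v → g s (0ᶠ ·ᵛ v))) +_) (∑-*ˡ allElems (q ∸ 1) _)) ⟩
      ∑F (λ s → ∑V (suc i) (λ v → g s (0ᶠ ·ᵛ v))) + (q ∸ 1) * ∑F (λ s → ∑V (suc i) (g s))
        ≡⟨ cong (λ z → ∑F (λ s → ∑V (suc i) (λ v → g s (0ᶠ ·ᵛ v))) + (q ∸ 1) * z) (∑V-suc (suc i) _) ⟨
      _ ∎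

  -- Supports modulo p.

  χ : ℕ → ℕ
  χ m = 𝟙 (¬? (p ∣? m))

  χ-∣ : ∀ {m} → p ∣ m → χ m ≡ 0
  χ-∣ {m} p∣m = 𝟙-no (¬? (p ∣? m)) (λ p∤m → p∤m p∣m)

  χ-∤ : ∀ {m} → ¬ p ∣ m → χ m ≡ 1
  χ-∤ {m} = 𝟙-yes (¬? (p ∣? m))

  χ≤1 : ∀ m → χ m ≤ 1
  χ≤1 m with p ∣? m
  ... | yes _ = z≤n
  ... | no _ = ≤-refl

  χ-+ : ∀ m n → χ (m + n) ≤ χ m + χ n
  χ-+ m n with p ∣? m | p ∣? n
  ... | yes a | yes b = ≤-reflexive (χ-∣ (∣m∣n⇒∣m+n a b))
  ... | yes a | no _ = χ≤1 (m + n)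
  ... | no _ | b = ≤-trans (χ≤1 (m + n)) (s≤s z≤n)

  χ-∑ : ∀ (xs : List A) f → χ (∑ xs f) ≤ ∑ xs (χ ∘ f)
  χ-∑ [] f = ≤-reflexive (χ-∣ (p ∣0))
  χ-∑ (x ∷ xs) f = ≤-trans (χ-+ (f x) _) (+-monoʳ-≤ (χ (f x)) (χ-∑ xs f))

  -- Counts vectors rather than points: for a function from `DualFunction` every support point
  -- contributes q - 1 of them.
  support : ∀ {n} → (V n → ℕ) → ℕ
  support {n} f = ∑V n (χ ∘ f)

  support≤ : ∀ {n} (f : V n → ℕ) → support f ≤ q ^ n
  support≤ {n} f = ≤-trans (∑-mono (allVecs n) (χ≤1 ∘ f)) (≤-reflexive (trans (∑V-const n 1) (*-identityʳ _)))

  Nonzero : ∀ {n} → (V n → ℕ) → Set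
  Nonzero f = ∃[ v ] ¬ p ∣ f v

  module _ {n : ℕ} (f : V n → ℕ) where
    extend-support : support (extend f) ≡ support f
    extend-support = begin
      ∑V (suc n) (χ ∘ extend f)
        ≡⟨ ∑V-suc n _ ⟩
      ∑F (λ x → ∑V n (λ v → χ (𝟙 (x ≟ᶠ 0ᶠ) * f v)))
        ≡⟨ ∑-cong allElems (λ x → trans (∑-cong (allVecs n) λ v → χ-𝟙 (x ≟ᶠ 0ᶠ) (f v)) (∑-*ˡ (allVecs n) (𝟙 (x ≟ᶠ 0ᶠ)) _)) ⟩
      ∑F (λ x → 𝟙 (x ≟ᶠ 0ᶠ) * support f)
        ≡⟨ 𝔽.∑-δ 0ᶠ (λ _ → support f) ⟩
      support f ∎
      where
      open ≡-Reasoning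
      χ-𝟙 : ∀ (d : Dec P) m → χ (𝟙 d * m) ≡ 𝟙 d * χ m
      χ-𝟙 (yes _) m = trans (cong χ (*-identityˡ m)) (sym (*-identityˡ (χ m)))
      χ-𝟙 (no _) m = χ-∣ (p ∣0)

    extend-invariant : (∀ a v → a ≢ 0ᶠ → f (a ·ᵛ v) ≡ f v) → ∀ a v → a ≢ 0ᶠ → extend f (a ·ᵛ v) ≡ extend f v
    extend-invariant inv-f a (x ∷ v) a≢0 = cong₂ _*_
      (𝟙-cong (a*x≡0⇒x≡0 a≢0) (λ x≡0 → trans (cong (a *ᶠ_) x≡0) (R.zeroʳ a)) (a *ᶠ x ≟ᶠ 0ᶠ) (x ≟ᶠ 0ᶠ)) (inv-f a v a≢0)

    extend-0∷ : ∀ v → extend f (0ᶠ ∷ v) ≡ f v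
    extend-0∷ v = trans (cong (_* f v) (𝟙-yes (0ᶠ ≟ᶠ 0ᶠ) refl)) (*-identityˡ (f v))

    extend-nonzero : Nonzero f → Nonzero (extend f)
    extend-nonzero (v , p∤) = 0ᶠ ∷ v , λ h → p∤ (subst (p ∣_) (extend-0∷ v) h)

  -- A single `extend` needs two consecutive orders, so the induction carries all orders from
  -- `r + 2` upwards; `annihilates-spread` supplies them at the start.
  lift-dual : ∀ r {n f} → DualFunction n 2 f → Nonzero f →
    ∃[ g ] DualFunction (r + n) (r + 2) g × Nonzero g × support g ≡ support f
  lift-dual r {n} {f} (dualFunction invt vanish ann) nz =
    let g , ginv , gvan , gann , gnz , gs = go r in g , dualFunction ginv gvan (gann _ ≤-refl) , gnz , gs
    where
    go : ∀ r → ∃[ g ] (∀ a v → a ≢ 0ᶠ → g (a ·ᵛ v) ≡ g v) × p ∣ g (0ᵛ {r + n}) ×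
      (∀ i → r + 2 ≤ i → Annihilates i g) × Nonzero g × support g ≡ support f
    go zero = f , invt , vanish , (λ { _ (s≤s (s≤s {n = i} z≤n)) → annihilates-spread f ann i }) , nz , refl
    go (suc r) = let g , ginv , gvan , gann , gnz , gs = go r in
      extend g , extend-invariant g ginv , subst (p ∣_) (sym (extend-0∷ g 0ᵛ)) gvan ,
      (λ { _ (s≤s le) → extend-annihilates g (gann _ le) (gann _ (m≤n⇒m≤1+n le)) }) ,
      extend-nonzero g gnz , trans (extend-support g) gs

  -- Lowering the dimension: projection from a point outside the support.

  module Projection {n j : ℕ} {f : V (suc n) → ℕ} (df : DualFunction (suc n) (suc j) f)
                    {r : V (suc n)} (r≢0 : r ≢ 0ᵛ) (p∣fr : p ∣ f r) where
    open DualFunction df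
    open Complement (complement r r≢0) public

    project : V n → ℕ
    project w = ∑F (λ s → f (s ·ᵛ r +ᵛ σ w))

    -- Scaling `w` by `a` permutes the coset over it up to the factor `a`. The coset over 0 is the
    -- line of `r`, where all values vanish modulo p. The sum of `project` over the image of `b` is
    -- the sum of `f` over the image of `r` together with the lifted `b`, one dimension higher.
    project-dual : DualFunction n j project
    project-dual = dualFunction pinv pvan pann
      where
      open ≡-Reasoning
      pinv : ∀ a w → a ≢ 0ᶠ → project (a ·ᵛ w) ≡ project w
      pinv a w a≢0 = begin
        ∑F (λ s → f (s ·ᵛ r +ᵛ σ (a ·ᵛ w)))
          ≡⟨ 𝔽.∑-reindex (a *ᶠ_) (inv a≢0 *ᶠ_) (cancel-inv′ a≢0) (cancel-inv a≢0) _ ⟨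
        ∑F (λ s → f ((a *ᶠ s) ·ᵛ r +ᵛ σ (a ·ᵛ w)))
          ≡⟨ ∑-cong allElems (λ s → trans (cong f (trans
               (cong₂ _+ᵛ_ (·ᵛ-assoc a s r) (homogeneous σ-linear a w)) (sym (·ᵛ-distribˡ a _ _)))) (invariant a _ a≢0)) ⟩
        ∑F (λ s → f (s ·ᵛ r +ᵛ σ w)) ∎
      pvan : p ∣ project 0ᵛ
      pvan = ∑-∣ allElems λ s → subst (p ∣_) (cong f (sym (trans (cong (s ·ᵛ r +ᵛ_) (preserves-0 σ-linear)) (+ᵛ-identityʳ _)))) (on-line s)
        where
        on-line : ∀ s → p ∣ f (s ·ᵛ r)
        on-line s with s ≟ᶠ 0ᶠ
        ... | yes refl = subst (p ∣_) (cong f (sym (0·ᵛ r))) vanish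
        ... | no s≢0 = subst (p ∣_) (sym (invariant s r s≢0)) p∣fr
      pann : Annihilates j project
      pann b = subst (p ∣_) (begin
        ∑V (suc j) (λ a → f (linComb a (r ∷ Vec.map σ b)))
          ≡⟨ ∑V-suc j _ ⟩
        ∑F (λ s → ∑V j (λ a → f (s ·ᵛ r +ᵛ linComb a (Vec.map σ b))))
          ≡⟨ ∑-swap allElems (allVecs j) _ ⟩
        ∑V j (λ a → ∑F (λ s → f (s ·ᵛ r +ᵛ linComb a (Vec.map σ b))))
          ≡⟨ ∑-cong (allVecs j) (λ a → ∑-cong allElems λ s → cong (λ z → f (s ·ᵛ r +ᵛ z)) (linComb-map σ-linear a b)) ⟩
        ∑V j (λ a → project (linComb a b)) ∎) (annihilates (r ∷ Vec.map σ b))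

    -- A coset with nonzero sum contains a vector with nonzero value, and different cosets are
    -- disjoint.
    project-support : support project ≤ support f
    project-support = ≤-trans (∑-mono (allVecs n) λ w → χ-∑ allElems (λ s → f (s ·ᵛ r +ᵛ σ w)))
      (≤-reflexive (sym (∑-decompose (χ ∘ f))))

  -- If some line through a point P of the support is tangent to it, project from another point of that line.
  -- Otherwise the support, which meets every line through P again, is large.
  descend : ∀ {n j f} → DualFunction (suc n) (suc j) f → Nonzero f →
    (∃[ g ] DualFunction n j g × Nonzero g × support g ≤ support f) ⊎ q ^ n ≤ support f
  descend {n} {j} {f} df (P , p∤fP)
    with 𝕍.search (λ w → 𝔽.check λ s → p ∣? f (s ·ᵛ P +ᵛ Complement.σ (complement P P≢0) w))
    where
    P≢0 : P ≢ 0ᵛ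
    P≢0 refl = p∤fP (DualFunction.vanish df)
  -- Each of the q^n cosets of the line of `P` then contains a vector of the support.
  ... | no ∄ = inj₂ (subst₂ _≤_ (trans (∑V-const n 1) (*-identityʳ _)) (sym (∑-decompose (χ ∘ f)))
          (∑-mono (allVecs n) λ w → n≢0⇒n>0 (let s , p∤ = hit w in 𝔽.∑-pos s λ e → 0≢1+n (trans (sym e) (χ-∤ p∤)))))
    where
    open Complement (complement P _)
    hit : ∀ w → ∃[ s ] ¬ p ∣ f (s ·ᵛ P +ᵛ σ w)
    hit w = decidable-stable (𝔽.search λ s → ¬? (p ∣? _)) λ none →
      ∄ (w , λ s → decidable-stable (p ∣? _) λ p∤ → none (s , p∤))
  ... | yes (w , tangent) = inj₁ (project , project-dual , (w′ , nonzero) , project-support)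
    where
    module C = Complement (complement P _)
    open DualFunction df
    r : V (suc n)
    -- The centre lies on the tangent line spanned by `P` and `σ w`. Taking `s = 1` in `tangent`
    -- excludes `r ≡ 0ᵛ`, and `s = 0` puts `r` outside the support.
    r = C.σ w
    r≢0 : r ≢ 0ᵛ
    r≢0 r≡0 = p∤fP (subst (λ v → p ∣ f v) (trans (cong₂ _+ᵛ_ (1·ᵛ P) r≡0) (+ᵛ-identityʳ P)) (tangent 1ᶠ))
    p∣fr : p ∣ f r
    p∣fr = subst (λ v → p ∣ f v) (trans (cong (_+ᵛ r) (0·ᵛ P)) (+ᵛ-identityˡ r)) (tangent 0ᶠ)
    open Projection df r≢0 p∣fr
    s₀ = proj₁ (decompose P)
    w′ = proj₁ (proj₂ (decompose P))
    P≡ : P ≡ s₀ ·ᵛ r +ᵛ σ w′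
    P≡ = proj₂ (proj₂ (decompose P))
    open ≡-Reasoning
    -- With `t = s - s₀`, the vector at `s` is `P` plus `t` times `r`, a multiple of a vector
    -- covered by `tangent`. So the coset through `P` has the value at `P` as its only nonzero term,
    -- and its sum is nonzero modulo p.
    off-P : ∀ s → s ≢ s₀ → p ∣ f (s ·ᵛ r +ᵛ σ w′)
    off-P s s≢s₀ = subst (p ∣_) (begin
        f (inv t≢0 ·ᵛ P +ᵛ r) ≡⟨ invariant t _ t≢0 ⟨
        f (t ·ᵛ (inv t≢0 ·ᵛ P +ᵛ r)) ≡⟨ cong f (begin
          t ·ᵛ (inv t≢0 ·ᵛ P +ᵛ r) ≡⟨ ·ᵛ-distribˡ t _ _ ⟩
          t ·ᵛ inv t≢0 ·ᵛ P +ᵛ t ·ᵛ r ≡⟨ cong (_+ᵛ t ·ᵛ r) (trans (scale-cancel t≢0 P) P≡) ⟩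
          (s₀ ·ᵛ r +ᵛ σ w′) +ᵛ t ·ᵛ r ≡⟨ +ᵛ-comm _ _ ⟩
          t ·ᵛ r +ᵛ (s₀ ·ᵛ r +ᵛ σ w′) ≡⟨ +ᵛ-assoc _ _ _ ⟨
          (t ·ᵛ r +ᵛ s₀ ·ᵛ r) +ᵛ σ w′ ≡⟨ cong (_+ᵛ σ w′) (·ᵛ-distribʳ t s₀ r) ⟨
          (t +ᶠ s₀) ·ᵛ r +ᵛ σ w′ ≡⟨ cong (λ z → z ·ᵛ r +ᵛ σ w′) t+s₀ ⟩
          s ·ᵛ r +ᵛ σ w′ ∎) ⟩
        f (s ·ᵛ r +ᵛ σ w′) ∎) (tangent (inv t≢0))
      where
      t = s +ᶠ (-ᶠ s₀)
      t+s₀ : t +ᶠ s₀ ≡ s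
      t+s₀ = trans (R.+-assoc _ _ _) (trans (cong (s +ᶠ_) (R.-‿inverseˡ s₀)) (R.+-identityʳ s))
      t≢0 : t ≢ 0ᶠ
      t≢0 t≡0 = s≢s₀ (trans (sym t+s₀) (trans (cong (_+ᶠ s₀) t≡0) (R.+-identityˡ s₀)))
    nonzero : ¬ p ∣ project w′
    nonzero p∣ = p∤fP (subst (λ v → p ∣ f v) (sym P≡) (∣-resp-% p (trans (∑-%-cong p allElems only-P)
      (cong (_% p) (𝔽.∑-δ s₀ λ s → f (s ·ᵛ r +ᵛ σ w′)))) p∣))
      where
      only-P : ∀ s → f (s ·ᵛ r +ᵛ σ w′) % p ≡ (𝟙 (s ≟ᶠ s₀) * f (s ·ᵛ r +ᵛ σ w′)) % p
      only-P s with s ≟ᶠ s₀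
      ... | yes _ = cong (_% p) (sym (*-identityˡ _))
      ... | no s≢s₀ = trans (n∣m⇒m%n≡0 _ p (off-P s s≢s₀)) (sym (n∣m⇒m%n≡0 0 p (p ∣0)))

  -- The difference mod p of the hyperplanes x₀ = 0 and x₁ = 0.
  hyperplanes : ∀ {n} → V (2 + n) → ℕ
  hyperplanes v = extend (λ _ → 1) v + (p ∸ 1) * extend (λ _ → 1) (tail v)

  suc-pred-p : 1 + (p ∸ 1) ≡ p
  suc-pred-p = m+[n∸m]≡n (<⇒≤ 1<p)

  -- A hyperplane is the extension of the constant 1, whose sums over images of F^1 and F^2 are q
  -- and q^2, both divisible by p. The second hyperplane is the first pulled back along `tail`.
  hyperplanes-dual : ∀ {n} → DualFunction (2 + n) 2 hyperplanes
  hyperplanes-dual {n} = dualFunction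
    (λ { a v@(_ ∷ _) a≢0 → cong₂ _+_ (h-inv a v a≢0) (cong ((p ∸ 1) *_) (h-inv a (tail v) a≢0)) })
    -- Both hyperplanes contain 0, so the value there is `1 + (p ∸ 1)`, that is p: zero modulo p but
    -- not in ℕ.
    (∣-reflexive (sym (trans (cong₂ (λ x y → x + (p ∸ 1) * y) (extend-0∷ {suc n} (λ _ → 1) 0ᵛ) (extend-0∷ {n} (λ _ → 1) 0ᵛ)) (trans (cong suc (*-identityʳ _)) suc-pred-p))))
    (λ b → subst (p ∣_) (sym (trans (∑-+ (allVecs 2) _ _) (cong (∑V 2 (λ a → h (linComb a b)) +_) (∑-*ˡ (allVecs 2) (p ∸ 1) _))))
      (∣m∣n⇒∣m+n (h-ann b) (∣n⇒∣m*n (p ∸ 1) (annihilates-linear h h-ann (linear-∘ linear-tail (linComb-linear b))))))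
    where
    h : ∀ {n} → V (suc n) → ℕ
    h = extend (λ _ → 1)
    one-ann : ∀ {n} j → Annihilates {n} (suc j) (λ _ → 1)
    one-ann j b = subst (p ∣_) (sym (∑V-const (suc j) 1)) (∣m⇒∣m*n 1 (∣m⇒∣m*n (q ^ j) p∣q))
    h-ann : ∀ {n} → Annihilates {suc n} 2 (extend (λ _ → 1))
    h-ann = extend-annihilates (λ _ → 1) (one-ann 0) (one-ann 1)
    h-inv : ∀ {n} a (v : V (suc n)) → a ≢ 0ᶠ → extend (λ _ → 1) (a ·ᵛ v) ≡ extend (λ _ → 1) v
    h-inv = extend-invariant (λ _ → 1) (λ _ _ _ → refl)

  hyperplanes-nonzero : ∀ {n} → Nonzero (hyperplanes {n})
  hyperplanes-nonzero {n} = 0ᶠ ∷ 1ᶠ ∷ 0ᵛ , λ p∣ → <⇒≱ 1<p (∣⇒≤ (subst (p ∣_) value p∣))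
    where
    value : hyperplanes {n} (0ᶠ ∷ 1ᶠ ∷ 0ᵛ) ≡ 1
    value = trans
      (cong₂ (λ x y → x + (p ∸ 1) * (y * 1)) (extend-0∷ {suc n} (λ _ → 1) (1ᶠ ∷ 0ᵛ)) (𝟙-no (1ᶠ ≟ᶠ 0ᶠ) (0≢1 ∘ sym)))
      (cong suc (*-zeroʳ (p ∸ 1)))

  -- Repeats `descend` until order 2 is reached. If one step meets a support without tangents, that
  -- support has at least as many vectors as all of F^(2+m), so any nonzero dual function there will
  -- do, and `hyperplanes` is one.
  reduce : ∀ r {m f} → DualFunction (r + (2 + m)) (r + 2) f → Nonzero f →
    ∃[ g ] DualFunction (2 + m) 2 g × Nonzero g × support g ≤ support f
  reduce zero {f = f} df nz = f , df , nz , ≤-refl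
  reduce (suc r) {m} df nz with descend df nz
  ... | inj₁ (g , dg , nz-g , sg) = let h , dh , nz-h , sh = reduce r dg nz-g in h , dh , nz-h , ≤-trans sh sg
  ... | inj₂ large = hyperplanes , hyperplanes-dual , hyperplanes-nonzero {m} ,
          ≤-trans (support≤ (hyperplanes {m})) (≤-trans (^-monoʳ-≤ q (m≤n+m (2 + m) r)) large)

  -- Minimum supports and their existence.

  Minimum : ℕ → ℕ → ℕ → Set
  Minimum n j s = (∃[ f ] DualFunction n j f × Nonzero f × support f ≡ s) ×
                  (∀ f → DualFunction n j f → Nonzero f → s ≤ support f)

  -- `lift-dual` attains the same value in the larger space, and `reduce` carries every competitor
  -- back to the smaller one.
  minimum-lift : ∀ r {m s} → Minimum (2 + m) 2 s → Minimum (r + (2 + m)) (r + 2) s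
  minimum-lift r ((f , df , nz , sf) , least) =
    (let g , dg , nz-g , sg = lift-dual r df nz in g , dg , nz-g , trans sg sf) ,
    λ g dg nz-g → let h , dh , nz-h , sh = reduce r dg nz-g in ≤-trans (least h dh nz-h) sh

  -- Passing to residues leaves finitely many functions to search.
  module _ {n : ℕ} {f g : V n → ℕ} (g≡f%p : ∀ v → g v ≡ f v % p) where
    private
      %-agree : ∀ v → f v % p ≡ g v % p
      %-agree v = trans (sym (m%n%n≡m%n (f v) p)) (cong (_% p) (sym (g≡f%p v)))

    residue-dual : ∀ {j} → DualFunction n j f → DualFunction n j g
    residue-dual {j} (dualFunction invt vanish ann) = dualFunction
      (λ a v a≢0 → trans (g≡f%p _) (trans (cong (_% p) (invt a v a≢0)) (sym (g≡f%p v))))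
      (∣-resp-% p (%-agree 0ᵛ) vanish)
      (λ b → ∣-resp-% p (∑-%-cong p (allVecs j) λ a → %-agree (linComb a b)) (ann b))

    residue-nonzero : Nonzero f → Nonzero g
    residue-nonzero (v , p∤) = v , λ p∣ → p∤ (∣-resp-% p (sym (%-agree v)) p∣)

    residue-support : support g ≡ support f
    residue-support = ∑-cong (allVecs n) λ v →
      𝟙-cong (λ p∤ p∣ → p∤ (∣-resp-% p (%-agree v) p∣)) (λ p∤ p∣ → p∤ (∣-resp-% p (sym (%-agree v)) p∣))
        (¬? (p ∣? g v)) (¬? (p ∣? f v))

  searchVec : ∀ n {P : Vec (Fin p) n → Set} → (∀ c → Dec (P c)) → Dec (∃ P)
  searchVec zero P? = map′ ([] ,_) (λ { ([] , h) → h }) (P? [])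
  searchVec (suc n) P? = map′ (λ { (x , c , h) → x ∷ c , h }) (λ { (x ∷ c , h) → x , c , h })
    (anyF? λ x → searchVec n λ c → P? (x ∷ c))

  -- A table of residues, one for each position in `allVecs n`; such tables can be searched
  -- exhaustively, unlike functions into ℕ.
  decode : ∀ n → Vec (Fin p) (length (allVecs n)) → V n → ℕ
  decode n c v = toℕ (Vec.lookup c (index (𝕍.complete v)))

  encode : ∀ {n} → (V n → ℕ) → Vec (Fin p) (length (allVecs n))
  encode {n} f = Vec.tabulate λ i → f (List.lookup (allVecs n) i) mod p

  decode-encode : ∀ {n} (f : V n → ℕ) v → decode n (encode f) v ≡ f v % p
  decode-encode {n} f v = begin
    toℕ (Vec.lookup (encode f) i) ≡⟨ cong toℕ (Vec.lookup∘tabulate _ i) ⟩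
    toℕ (f (List.lookup (allVecs n) i) mod p) ≡⟨ toℕ-fromℕ< _ ⟩
    f (List.lookup (allVecs n) i) % p ≡⟨ cong (λ u → f u % p) (sym (lookup-index (𝕍.complete v))) ⟩
    f v % p ∎
    where
    open ≡-Reasoning
    i = index (𝕍.complete v)

  dual? : ∀ {n} (f : V n → ℕ) → Dec (DualFunction n 2 f)
  dual? f = map′ (λ { (i , z , a) → dualFunction i z λ { (u ∷ v ∷ []) → a u v } })
                 (λ { (dualFunction i z a) → i , z , λ u v → a (u ∷ v ∷ []) })
    ((𝔽.check λ a → 𝕍.check λ v → ¬? (a ≟ᶠ 0ᶠ) →-dec (f (a ·ᵛ v) ℕ.≟ f v)) ×-dec
     (p ∣? f 0ᵛ) ×-dec
     (𝕍.check λ u → 𝕍.check λ v → p ∣? ∑V 2 λ a → f (linComb a (u ∷ v ∷ []))))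

  -- Well-founded descent on the support: the search over tables either produces a smaller support
  -- or proves minimality, since `encode` turns every competitor into a table.
  minimum : ∀ {n} (f : V n → ℕ) → DualFunction n 2 f → Nonzero f → ∃ (Minimum n 2)
  minimum {n} f = go f (<-wellFounded (support f))
    where
    go : ∀ (f : V n → ℕ) → Acc _<_ (support f) → DualFunction n 2 f → Nonzero f → ∃ (Minimum n 2)
    go f (acc smaller) df nz with searchVec (length (allVecs n))
      (λ c → dual? (decode n c) ×-dec 𝕍.search (λ v → ¬? (p ∣? decode n c v)) ×-dec (support (decode n c) <? support f))
    ... | yes (c , dc , nz-c , c<f) = go (decode n c) (smaller c<f) dc nz-c
    ... | no ∄ = support f , (f , df , nz , refl) , λ g dg nz-g → ≮⇒≥ λ g<f →
            let e = decode-encode g in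
            ∄ (encode g , residue-dual e dg , residue-nonzero e nz-g , subst (_< support f) (sym (residue-support e)) g<f)

∑≢0⇒∃ : ∀ (xs : List A) {f : A → ℕ} → ∑ xs f ≢ 0 → ∃[ x ] f x ≢ 0
∑≢0⇒∃ [] h = contradiction refl h
∑≢0⇒∃ (x ∷ xs) {f} h with f x ℕ.≟ 0
... | no fx≢0 = x , fx≢0
... | yes fx≡0 = ∑≢0⇒∃ xs (λ e → h (cong₂ _+_ fx≡0 e))

-- Passage between vectors and normalized points.

module Words {q : ℕ} (F : FiniteField q) (p : ℕ) .{{_ : NonZero p}} (1<p : 1 < p) (p∣q : p ∣ q) where
  open VectorSpace F p
  open DualFunctions F p 1<p p∣q
  open Linear

  isNorm-0∷ : ∀ {n} (v : V n) → isNorm (0ᶠ ∷ v) ≡ isNorm v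
  isNorm-0∷ v rewrite dec-true (0ᶠ ≟ᶠ 0ᶠ) refl = refl

  isNorm-≢0 : ∀ {n x} (v : V n) → x ≢ 0ᶠ → isNorm (x ∷ v) ≡ (x == 1ᶠ)
  isNorm-≢0 {x = x} v x≢0 rewrite dec-false (x ≟ᶠ 0ᶠ) x≢0 = refl

  ==⇒≡ : ∀ {x y} → T (x == y) → x ≡ y
  ==⇒≡ {x} {y} t = decidable-stable (x ≟ᶠ y) λ x≢y → subst T (dec-false (x ≟ᶠ y) x≢y) t

  ≡⇒== : ∀ {x y} → x ≡ y → T (x == y)
  ≡⇒== {x} {y} e = subst T (sym (dec-true (x ≟ᶠ y) e)) _

  isNorm-0ᵛ : ∀ n → ¬ T (isNorm (0ᵛ {n}))
  isNorm-0ᵛ zero ()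
  isNorm-0ᵛ (suc n) t = isNorm-0ᵛ n (subst T (isNorm-0∷ (0ᵛ {n})) t)

  -- The first nonzero entry of `v` is 1, so that of `a ·ᵛ v` is `a`.
  isNorm-unique : ∀ {n} a (v : V n) → T (isNorm v) → T (isNorm (a ·ᵛ v)) → a ≡ 1ᶠ
  isNorm-unique {n} a v t t′ with a ≟ᶠ 0ᶠ
  ... | yes refl = contradiction (subst (T ∘ isNorm) (0·ᵛ v) t′) (isNorm-0ᵛ n)
  ... | no a≢0 = go v t t′
    where
    go : ∀ {n} (v : V n) → T (isNorm v) → T (isNorm (a ·ᵛ v)) → a ≡ 1ᶠ
    go (x ∷ v) t t′ with x ≟ᶠ 0ᶠ
    ... | yes refl = go v (subst T (isNorm-0∷ v) t)
            (subst T (isNorm-0∷ (a ·ᵛ v)) (subst (λ z → T (isNorm (z ∷ a ·ᵛ v))) (R.zeroʳ a) t′))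
    ... | no x≢0 = begin
          a ≡⟨ R.*-identityʳ a ⟨
          a *ᶠ 1ᶠ ≡⟨ cong (a *ᶠ_) (==⇒≡ (subst T (isNorm-≢0 v x≢0) t)) ⟨
          a *ᶠ x ≡⟨ ==⇒≡ (subst T (isNorm-≢0 (a ·ᵛ v) (x≢0 ∘ a*x≡0⇒x≡0 a≢0)) t′) ⟩
          1ᶠ ∎
      where open ≡-Reasoning

  N : ∀ {n} → V n → ℕ
  N v = 𝟙 (T? (isNorm v))

  -- Slice by the first entry. All slices with nonzero entry have the same sum, by scaling, and the
  -- slice with entry 1 consists of normalized vectors; the slice with entry 0 is handled by
  -- induction.
  ∑-normalized : ∀ n (G : V n → ℕ) → (∀ a v → a ≢ 0ᶠ → G (a ·ᵛ v) ≡ G v) →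
    ∑V n G ≡ G 0ᵛ + (q ∸ 1) * ∑V n (λ v → N v * G v)
  ∑-normalized zero G invt = cong (G [] +_) (sym (*-zeroʳ (q ∸ 1)))
  ∑-normalized (suc n) G invt = begin
    ∑V (suc n) G
      ≡⟨ ∑V-suc n G ⟩
    ∑F (λ x → Y x)
      ≡⟨ ∑F-split Y (Y 1ᶠ) Y-const ⟩
    Y 0ᶠ + (q ∸ 1) * Y 1ᶠ
      ≡⟨ cong (_+ (q ∸ 1) * Y 1ᶠ) (∑-normalized n (λ v → G (0ᶠ ∷ v)) λ a v a≢0 →
           trans (cong (λ z → G (z ∷ a ·ᵛ v)) (sym (R.zeroʳ a))) (invt a (0ᶠ ∷ v) a≢0)) ⟩
    (G 0ᵛ + (q ∸ 1) * X) + (q ∸ 1) * Y 1ᶠ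
      ≡⟨ trans (+-assoc (G 0ᵛ) _ _) (cong (G 0ᵛ +_) (sym (*-distribˡ-+ (q ∸ 1) X (Y 1ᶠ)))) ⟩
    G 0ᵛ + (q ∸ 1) * (X + Y 1ᶠ)
      ≡⟨ cong (λ z → G 0ᵛ + (q ∸ 1) * z) (sym normalized) ⟩
    G 0ᵛ + (q ∸ 1) * ∑V (suc n) (λ v → N v * G v) ∎
    where
    open ≡-Reasoning
    Y : Carrier → ℕ
    Y x = ∑V n (λ v → G (x ∷ v))
    X : ℕ
    X = ∑V n (λ v → N v * G (0ᶠ ∷ v))
    Y-const : ∀ x → x ≢ 0ᶠ → Y x ≡ Y 1ᶠ
    Y-const x x≢0 = begin
      Y x ≡⟨ ∑V-scale x≢0 (λ v → G (x ∷ v)) ⟨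
      ∑V n (λ v → G (x ∷ x ·ᵛ v)) ≡⟨ ∑-cong (allVecs n) (λ v →
        trans (cong (λ z → G (z ∷ x ·ᵛ v)) (sym (R.*-identityʳ x))) (invt x (1ᶠ ∷ v) x≢0)) ⟩
      Y 1ᶠ ∎
    slice : ∀ x → ∑V n (λ v → N (x ∷ v) * G (x ∷ v)) ≡ 𝟙 (x ≟ᶠ 0ᶠ) * X + 𝟙 (x ≟ᶠ 1ᶠ) * Y x
    slice x with x ≟ᶠ 0ᶠ
    ... | yes refl = begin
      ∑V n (λ v → N (0ᶠ ∷ v) * G (0ᶠ ∷ v))
        ≡⟨ ∑-cong (allVecs n) (λ v → cong (λ b → 𝟙 (T? b) * G (0ᶠ ∷ v)) (isNorm-0∷ v)) ⟩
      X ≡⟨ trans (sym (+-identityʳ X)) (cong₂ _+_ (sym (*-identityˡ X)) (cong (_* Y 0ᶠ) (sym (𝟙-no (0ᶠ ≟ᶠ 1ᶠ) 0≢1)))) ⟩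
      1 * X + 𝟙 (0ᶠ ≟ᶠ 1ᶠ) * Y 0ᶠ ∎
    ... | no x≢0 = begin
      ∑V n (λ v → N (x ∷ v) * G (x ∷ v))
        ≡⟨ ∑-cong (allVecs n) (λ v → cong (_* G (x ∷ v)) (𝟙-cong
             (λ t → ==⇒≡ (subst T (isNorm-≢0 v x≢0) t)) (λ e → subst T (sym (isNorm-≢0 v x≢0)) (≡⇒== e))
             (T? (isNorm (x ∷ v))) (x ≟ᶠ 1ᶠ))) ⟩
      ∑V n (λ v → 𝟙 (x ≟ᶠ 1ᶠ) * G (x ∷ v))
        ≡⟨ ∑-*ˡ (allVecs n) (𝟙 (x ≟ᶠ 1ᶠ)) _ ⟩
      𝟙 (x ≟ᶠ 1ᶠ) * Y x ∎
    normalized : ∑V (suc n) (λ v → N v * G v) ≡ X + Y 1ᶠ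
    normalized = begin
      ∑V (suc n) (λ v → N v * G v)
        ≡⟨ trans (∑V-suc n _) (∑-cong allElems slice) ⟩
      ∑F (λ x → 𝟙 (x ≟ᶠ 0ᶠ) * X + 𝟙 (x ≟ᶠ 1ᶠ) * Y x)
        ≡⟨ ∑-+ allElems _ _ ⟩
      ∑F (λ x → 𝟙 (x ≟ᶠ 0ᶠ) * X) + ∑F (λ x → 𝟙 (x ≟ᶠ 1ᶠ) * Y x)
        ≡⟨ cong₂ _+_ (𝔽.∑-δ 0ᶠ (λ _ → X)) (𝔽.∑-δ 1ᶠ Y) ⟩
      X + Y 1ᶠ ∎

  ∑-points : ∀ m (G : V (suc m) → ℕ) → ∑ (allPoints m) (G ∘ proj₁) ≡ ∑V (suc m) (λ v → N v * G v)
  ∑-points m G = trans (∑-mapMaybe toPoint (allVecs (suc m)) (G ∘ proj₁)) (∑-cong (allVecs (suc m)) at)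
    where
    at : ∀ v → maybe′ (G ∘ proj₁) 0 (toPoint v) ≡ N v * G v
    at v with T? (isNorm v)
    ... | yes _ = sym (*-identityˡ (G v))
    ... | no _ = refl

  ∑-projective : ∀ {m} (G : V (suc m) → ℕ) → (∀ a v → a ≢ 0ᶠ → G (a ·ᵛ v) ≡ G v) →
    ∑V (suc m) G ≡ G 0ᵛ + (q ∸ 1) * ∑ (allPoints m) (G ∘ proj₁)
  ∑-projective {m} G invt = trans (∑-normalized (suc m) G invt) (cong (λ z → G 0ᵛ + (q ∸ 1) * z) (sym (∑-points m G)))

  toPoint-normalized : ∀ {m} (P : Point m) → toPoint (proj₁ P) ≡ just P
  toPoint-normalized (v , t) with T? (isNorm v)
  ... | yes t′ = cong (λ z → just (v , z)) (T-irrelevant t′ t)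
  ... | no ¬t = contradiction t ¬t

  toPoint-¬normalized : ∀ {m} (v : V (suc m)) → ¬ T (isNorm v) → toPoint v ≡ nothing
  toPoint-¬normalized v ¬t with T? (isNorm v)
  ... | yes t = contradiction t ¬t
  ... | no _ = refl

  -- Homogeneous representatives of words, incidence vectors and orthogonality.

  _Represents_ : ∀ {m} → (V (suc m) → ℕ) → Word m → Set
  f Represents c = ∀ P → toℕ (c P) ≡ f (proj₁ P)

  atPoint : ∀ {m} → Word m → V (suc m) → ℕ
  atPoint c v = maybe′ (toℕ ∘ c) 0 (toPoint v)

  -- At most one multiple of v is normalized, so at most one summand is nonzero.
  homogenize : ∀ {m} → Word m → V (suc m) → ℕ
  homogenize c v = ∑F (λ a → atPoint c (a ·ᵛ v))

  homogenize-invariant : ∀ {m} (c : Word m) a v → a ≢ 0ᶠ → homogenize c (a ·ᵛ v) ≡ homogenize c v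
  homogenize-invariant c a v a≢0 = begin
    ∑F (λ b → atPoint c (b ·ᵛ a ·ᵛ v))
      ≡⟨ ∑-cong allElems (λ b → cong (atPoint c) (trans (·ᵛ-comm b a v) (sym (·ᵛ-assoc a b v)))) ⟩
    ∑F (λ b → atPoint c ((a *ᶠ b) ·ᵛ v))
      ≡⟨ 𝔽.∑-reindex (a *ᶠ_) (inv a≢0 *ᶠ_) (cancel-inv′ a≢0) (cancel-inv a≢0) (λ b → atPoint c (b ·ᵛ v)) ⟩
    ∑F (λ b → atPoint c (b ·ᵛ v)) ∎
    where open ≡-Reasoning

  homogenize-0 : ∀ {m} (c : Word m) → homogenize c 0ᵛ ≡ 0
  homogenize-0 {m} c = ∑-zero allElems λ a → cong (maybe′ (toℕ ∘ c) 0)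
    (toPoint-¬normalized (a ·ᵛ 0ᵛ) λ t → isNorm-0ᵛ (suc m) (subst (T ∘ isNorm) (·ᵛ-zero {suc m} a) t))

  homogenize-represents : ∀ {m} (c : Word m) → homogenize c Represents c
  homogenize-represents c P@(v , t) = sym (trans (∑-cong allElems at) (𝔽.∑-δ 1ᶠ (λ _ → toℕ (c P))))
    where
    at : ∀ a → atPoint c (a ·ᵛ v) ≡ 𝟙 (a ≟ᶠ 1ᶠ) * toℕ (c P)
    at a with a ≟ᶠ 1ᶠ
    ... | yes refl = trans (cong (maybe′ (toℕ ∘ c) 0) (trans (cong toPoint (1·ᵛ v)) (toPoint-normalized P))) (sym (*-identityˡ _))
    ... | no a≢1 = cong (maybe′ (toℕ ∘ c) 0) (toPoint-¬normalized (a ·ᵛ v) (a≢1 ∘ isNorm-unique a v t))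

  -- For independent `b` this is the incidence indicator of the span. Written as a count of
  -- coefficient tuples, it allows sums over tuples to be regrouped by their value.
  coverage : ∀ {m k} → Vec (V (suc m)) (suc k) → V (suc m) → ℕ
  coverage {k = k} b v = ∑V (suc k) (λ a → 𝟙 (linComb a b ≟ᵛ v))

  coverage-invariant : ∀ {m k} (b : Vec (V (suc m)) (suc k)) a v → a ≢ 0ᶠ → coverage b (a ·ᵛ v) ≡ coverage b v
  coverage-invariant {k = k} b a v a≢0 = trans (sym (∑V-scale a≢0 λ u → 𝟙 (linComb u b ≟ᵛ a ·ᵛ v))) (∑-cong (allVecs (suc k)) λ u →
    𝟙-cong
      (λ e → trans (sym (scale-cancel′ a≢0 _)) (trans (cong (inv a≢0 ·ᵛ_) (trans (sym (homogeneous (linComb-linear b) a u)) e)) (scale-cancel′ a≢0 v)))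
      (λ e → trans (homogeneous (linComb-linear b) a u) (cong (a ·ᵛ_) e))
      (linComb (a ·ᵛ u) b ≟ᵛ a ·ᵛ v) (linComb u b ≟ᵛ v))

  independent⇒injective : ∀ {n r} {b : Vec (V n) r} → Independent b → ∀ {u v} → linComb u b ≡ linComb v b → u ≡ v
  independent⇒injective {b = b} ind {u} {v} e = begin
    u ≡⟨ +ᵛ-identityʳ u ⟨
    u +ᵛ 0ᵛ ≡⟨ cong (u +ᵛ_) (-v+v) ⟨
    u +ᵛ (-v +ᵛ v) ≡⟨ +ᵛ-assoc u -v v ⟨
    (u +ᵛ -v) +ᵛ v ≡⟨ cong (_+ᵛ v) (ind (u +ᵛ -v) difference) ⟩
    0ᵛ +ᵛ v ≡⟨ +ᵛ-identityˡ v ⟩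
    v ∎
    where
    open ≡-Reasoning
    -v = (-ᶠ 1ᶠ) ·ᵛ v
    -v+v : -v +ᵛ v ≡ 0ᵛ
    -v+v = trans (cong (-v +ᵛ_) (sym (1·ᵛ v))) (-u+u 1ᶠ v)
    difference : linComb (u +ᵛ -v) b ≡ 0ᵛ
    difference = begin
      linComb (u +ᵛ -v) b ≡⟨ additive (linComb-linear b) u -v ⟩
      linComb u b +ᵛ linComb -v b ≡⟨ cong (_+ᵛ linComb -v b) e ⟩
      linComb v b +ᵛ linComb -v b ≡⟨ additive (linComb-linear b) v -v ⟨
      linComb (v +ᵛ -v) b ≡⟨ cong (λ z → linComb z b) (trans (+ᵛ-comm v -v) -v+v) ⟩
      linComb 0ᵛ b ≡⟨ preserves-0 (linComb-linear b) ⟩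
      0ᵛ ∎

  independent? : ∀ {n r} (b : Vec (V n) r) → Independent b ⊎ ∃[ a ] a ≢ 0ᵛ × linComb a b ≡ 0ᵛ
  independent? b with 𝕍.search (λ a → ¬? (a ≟ᵛ 0ᵛ) ×-dec (linComb a b ≟ᵛ 0ᵛ))
  ... | yes dependent = inj₂ dependent
  ... | no ∄ = inj₁ λ a e → decidable-stable (a ≟ᵛ 0ᵛ) λ a≢0 → ∄ (a , a≢0 , e)

  coverage-∈ : ∀ {m k} (S : Subspace m k) P → P ∈S S → coverage (proj₁ S) (proj₁ P) ≡ 1
  coverage-∈ {k = k} (b , ind) (v , _) (u , refl) = trans
    (∑-cong (allVecs (suc k)) λ a → trans (𝟙-cong (independent⇒injective ind) (cong (λ z → linComb z b)) (linComb a b ≟ᵛ v) (a ≟ᵛ u)) (sym (*-identityʳ _)))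
    (𝕍.∑-δ u (λ _ → 1))

  coverage-∉ : ∀ {m k} (S : Subspace m k) P → ¬ P ∈S S → coverage (proj₁ S) (proj₁ P) ≡ 0
  coverage-∉ {k = k} (b , _) (v , _) P∉S = ∑-zero (allVecs (suc k)) λ a → 𝟙-no (linComb a b ≟ᵛ v) λ e → P∉S (a , e)

  _∈S?_ : ∀ {m k} (P : Point m) (S : Subspace m k) → Dec (P ∈S S)
  P ∈S? S = 𝕍.search λ a → linComb a (proj₁ S) ≟ᵛ proj₁ P

  incidence≡coverage : ∀ {m k} {S : Subspace m k} {v} → IsIncidenceVector S v → ∀ P → toℕ (v P) ≡ coverage (proj₁ S) (proj₁ P)
  incidence≡coverage {S = S} inc P with P ∈S? S
  ... | yes P∈S = trans (proj₁ (inc P) P∈S) (sym (coverage-∈ S P P∈S))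
  ... | no P∉S = trans (proj₂ (inc P) P∉S) (sym (coverage-∉ S P P∉S))

  incidence-exists : ∀ {m k} (S : Subspace m k) → ∃ (IsIncidenceVector S)
  incidence-exists S = (λ P → coverage (proj₁ S) (proj₁ P) mod p) , λ P →
    (λ P∈S → trans (toℕ-fromℕ< _) (trans (cong (_% p) (coverage-∈ S P P∈S)) (m<n⇒m%n≡m 1<p))) ,
    (λ P∉S → trans (toℕ-fromℕ< _) (trans (cong (_% p) (coverage-∉ S P P∉S)) (n∣m⇒m%n≡0 0 p (p ∣0))))

  module _ {m : ℕ} {c : Word m} {f : V (suc m) → ℕ} (rep : f Represents c)
           (invt : ∀ a v → a ≢ 0ᶠ → f (a ·ᵛ v) ≡ f v) (vanish : p ∣ f 0ᵛ) where

    -- Grouping the tuples by the vector they produce weights `f` by `coverage`; both factors are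
    -- invariant, so the sum over vectors becomes one over points.
    ∑-subspace : ∀ {k} {S : Subspace m k} {v} → IsIncidenceVector S v →
      ∑V (suc k) (λ a → f (linComb a (proj₁ S))) ≡
      f 0ᵛ * coverage (proj₁ S) 0ᵛ + (q ∸ 1) * ∑ (allPoints m) (λ P → toℕ (c P) * toℕ (v P))
    ∑-subspace {k} {S@(b , _)} {v} inc = begin
      ∑V (suc k) (λ a → f (linComb a b))
        ≡⟨ ∑-cong (allVecs (suc k)) (λ a → 𝕍.∑-δ (linComb a b) f) ⟨
      ∑V (suc k) (λ a → ∑V (suc m) (λ x → 𝟙 (x ≟ᵛ linComb a b) * f x))
        ≡⟨ ∑-swap (allVecs (suc k)) (allVecs (suc m)) _ ⟩
      ∑V (suc m) (λ x → ∑V (suc k) (λ a → 𝟙 (x ≟ᵛ linComb a b) * f x))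
        ≡⟨ ∑-cong (allVecs (suc m)) (λ x → trans (∑-cong (allVecs (suc k)) λ a →
             trans (*-comm _ (f x)) (cong (f x *_) (𝟙-cong sym sym (x ≟ᵛ linComb a b) (linComb a b ≟ᵛ x))))
             (∑-*ˡ (allVecs (suc k)) (f x) _)) ⟩
      ∑V (suc m) (λ x → f x * coverage b x)
        ≡⟨ ∑-projective (λ x → f x * coverage b x) (λ a x a≢0 → cong₂ _*_ (invt a x a≢0) (coverage-invariant b a x a≢0)) ⟩
      f 0ᵛ * coverage b 0ᵛ + (q ∸ 1) * ∑ (allPoints m) (λ P → f (proj₁ P) * coverage b (proj₁ P))
        ≡⟨ cong (λ z → f 0ᵛ * coverage b 0ᵛ + (q ∸ 1) * z) (∑-cong (allPoints m) λ P →
             cong₂ _*_ (rep P) (incidence≡coverage {S = S} {v} inc P)) ⟨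
      f 0ᵛ * coverage b 0ᵛ + (q ∸ 1) * ∑ (allPoints m) (λ P → toℕ (c P) * toℕ (v P)) ∎
      where open ≡-Reasoning

    -- Duality speaks only of independent `b`, through the incidence vector of their span. For
    -- dependent `b`, the sum is constant along a kernel vector `u`, so every term occurs q times.
    dual⇒annihilates : ∀ {k} → Dual (Code m k) c → Annihilates (suc k) f
    dual⇒annihilates {k} dual b with independent? b
    ... | inj₁ ind = let v , inc = incidence-exists S in
          subst (p ∣_) (sym (∑-subspace {S = S} {v} inc)) (∣m∣n⇒∣m+n (∣m⇒∣m*n _ vanish)
            (∣n⇒∣m*n (q ∸ 1) (m%n≡0⇒n∣m _ p (dual v (spanned v inc)))))
      where
      S : Subspace m k
      S = b , ind
      spanned : ∀ v → IsIncidenceVector S v → Code m k v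
      -- The combination with the single coefficient 1, which `1 mod p` is because p exceeds 1.
      spanned v inc = (1 mod p , v) ∷ [] , (S , inc) ∷ [] , λ P → sym (begin
        (toℕ (1 mod p) * toℕ (v P) + 0) % p
          ≡⟨ cong (_% p) (trans (+-identityʳ _) (cong (_* toℕ (v P)) (trans (toℕ-fromℕ< _) (m<n⇒m%n≡m 1<p)))) ⟩
        (1 * toℕ (v P)) % p ≡⟨ cong (_% p) (*-identityˡ _) ⟩
        toℕ (v P) % p ≡⟨ m<n⇒m%n≡m (toℕ<n (v P)) ⟩
        toℕ (v P) ∎)
        where open ≡-Reasoning
    ... | inj₂ (u , u≢0 , Lu≡0) = subst (p ∣_) (sym (∑-decompose _)) (∑-∣ (allVecs k) λ w →
          subst (p ∣_) (sym (trans (∑-cong allElems (λ s → cong f (line s w))) (∑F-const (f (linComb (σ w) b))))) (∣m⇒∣m*n _ p∣q))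
      where
      open Complement (complement u u≢0)
      line : ∀ s w → linComb (s ·ᵛ u +ᵛ σ w) b ≡ linComb (σ w) b
      line s w = trans (additive (linComb-linear b) (s ·ᵛ u) (σ w)) (trans
        (cong (_+ᵛ linComb (σ w) b) (trans (homogeneous (linComb-linear b) s u) (trans (cong (s ·ᵛ_) Lu≡0) (·ᵛ-zero s))))
        (+ᵛ-identityˡ _))

    -- By linearity it suffices to treat the generators. For these `∑-subspace` gives q - 1 times
    -- the scalar product, and the factor cancels modulo p.
    annihilates⇒dual : ∀ {k} → Annihilates (suc k) f → Dual (Code m k) c
    annihilates⇒dual {k} ann c′ (L , gens , c′≡) = n∣m⇒m%n≡0 _ p
      (∣-resp-% p (trans (sym (∑-%-cong p (allPoints m) λ P → *-%ʳ p (toℕ (c P)) _))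
                         (cong (_% p) (∑-cong (allPoints m) λ P → cong (toℕ (c P) *_) (sym (c′≡ P)))))
        (subst (p ∣_) (sym expand) (∑-∣-All (All.map (λ {av} → generator av) gens))))
      where
      open ≡-Reasoning
      term : Fin p × Word m → Point m → ℕ
      term (a , v) P = toℕ a * toℕ (v P)
      expand : ∑ (allPoints m) (λ P → toℕ (c P) * ∑ L (λ av → term av P)) ≡
        ∑ L (λ av → toℕ (proj₁ av) * ∑ (allPoints m) (λ P → toℕ (c P) * toℕ (proj₂ av P)))
      expand = begin
        ∑ (allPoints m) (λ P → toℕ (c P) * ∑ L (λ av → term av P))
          ≡⟨ ∑-cong (allPoints m) (λ P → ∑-*ˡ L (toℕ (c P)) _) ⟨
        ∑ (allPoints m) (λ P → ∑ L (λ av → toℕ (c P) * term av P))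
          ≡⟨ ∑-swap (allPoints m) L _ ⟩
        ∑ L (λ av → ∑ (allPoints m) (λ P → toℕ (c P) * term av P))
          ≡⟨ ∑-cong L (λ (a , v) → trans (∑-cong (allPoints m) λ P →
               trans (sym (*-assoc (toℕ (c P)) (toℕ a) _)) (trans (cong (_* toℕ (v P)) (*-comm (toℕ (c P)) (toℕ a))) (*-assoc (toℕ a) _ _)))
               (∑-*ˡ (allPoints m) (toℕ a) _)) ⟩
        ∑ L (λ av → toℕ (proj₁ av) * ∑ (allPoints m) (λ P → toℕ (c P) * toℕ (proj₂ av P))) ∎
      generator : ∀ av → ∃[ S ] IsIncidenceVector {m} {k} S (proj₂ av) →
        p ∣ toℕ (proj₁ av) * ∑ (allPoints m) (λ P → toℕ (c P) * toℕ (proj₂ av P))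
      generator (a , v) (S , inc) = ∣n⇒∣m*n (toℕ a) (p∣pred*⇒p∣ _
        (∣m+n∣m⇒∣n (subst (p ∣_) (∑-subspace {S = S} {v} inc) (ann (proj₁ S))) (∣m⇒∣m*n _ vanish)))

    support≡weight : support f ≡ (q ∸ 1) * weight c
    support≡weight = begin
      support f
        ≡⟨ ∑-projective (χ ∘ f) (λ a v a≢0 → cong χ (invt a v a≢0)) ⟩
      χ (f 0ᵛ) + (q ∸ 1) * ∑ (allPoints m) (χ ∘ f ∘ proj₁)
        ≡⟨ cong₂ (λ x y → x + (q ∸ 1) * y) (χ-∣ vanish) (∑-cong (allPoints m) λ P → trans (cong χ (sym (rep P))) (sym (χ-residue _ (toℕ<n (c P))))) ⟩
      (q ∸ 1) * weight c ∎
      where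
      open ≡-Reasoning
      χ-residue : ∀ x → x < p → (if does (x ℕ.≟ 0) then 0 else 1) ≡ χ x
      χ-residue zero _ = sym (χ-∣ (p ∣0))
      χ-residue (suc x) x<p = sym (χ-∤ (>⇒∤ x<p))

    nonzeroWord⇒nonzero : NonZeroWord c → Nonzero f
    nonzeroWord⇒nonzero (P , cP≢0) = proj₁ P , λ p∣ →
      >⇒∤ {{≢-nonZero cP≢0}} (toℕ<n (c P)) (subst (p ∣_) (sym (rep P)) p∣)

    -- Goes through the weight, which cannot be 0 when the support is not empty; no normalized
    -- multiple of `v` has to be computed.
    nonzero⇒nonzeroWord : Nonzero f → NonZeroWord c
    nonzero⇒nonzeroWord (v , p∤fv) = let P , h = ∑≢0⇒∃ (allPoints m) weight≢0 in P , λ cP≡0 →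
      h (cong (λ x → if does (x ℕ.≟ 0) then 0 else 1) cP≡0)
      where
      weight≢0 : weight c ≢ 0
      weight≢0 w≡0 = 𝕍.∑-pos v (λ e → 0≢1+n (trans (sym e) (χ-∤ p∤fv)))
        (trans support≡weight (trans (cong ((q ∸ 1) *_) w≡0) (*-zeroʳ (q ∸ 1))))

  -- Minimum weights of the dual codes.

  instance
    q∸1-nonZero : NonZero (q ∸ 1)
    q∸1-nonZero = >-nonZero (m<n⇒0<n∸m (≤-trans 1<p (∣⇒≤ p∣q)))

  -- The values of `f` are first replaced by their residues, which keeps duality and support; at the
  -- points they form a word.
  codeword : ∀ {m k f} → DualFunction (suc m) (suc k) f → Nonzero f →
    ∃[ c ] Dual (Code m k) c × NonZeroWord c × support f ≡ (q ∸ 1) * weight c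
  codeword {m} {k} {f} df nz = c , annihilates⇒dual rep invariant vanish annihilates ,
    nonzero⇒nonzeroWord rep invariant vanish (residue-nonzero (λ _ → refl) nz) ,
    trans (sym (residue-support {f = f} (λ _ → refl))) (support≡weight rep invariant vanish)
    where
    open DualFunction (residue-dual {f = f} {g = λ v → f v % p} (λ _ → refl) df)
    c : Word m
    c P = f (proj₁ P) mod p
    rep : (λ v → f v % p) Represents c
    rep P = toℕ-fromℕ< _

  -- `codeword` turns the minimal function into a word, and `homogenize` turns a competing word into
  -- a function; the common factor q - 1 cancels.
  minimum⇒IsMinWeight : ∀ {m k d} → Minimum (suc m) (suc k) ((q ∸ 1) * d) → IsMinWeight (Dual (Code m k)) d
  minimum⇒IsMinWeight {m} {k} {d} ((f , df , nz , sf) , least) =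
    (let c , dual , nz-c , sc = codeword df nz in
      c , dual , nz-c , *-cancelˡ-≡ _ _ (q ∸ 1) (trans (sym sc) sf)) ,
    λ c dual nz-c →
      let rep = homogenize-represents c
          invt = homogenize-invariant c
          vanish = subst (p ∣_) (sym (homogenize-0 c)) (p ∣0)
      in *-cancelˡ-≤ (q ∸ 1) (subst ((q ∸ 1) * d ≤_) (support≡weight rep invt vanish)
           (least (homogenize c) (dualFunction invt vanish (dual⇒annihilates rep invt vanish dual))
             (nonzeroWord⇒nonzero rep invt vanish nz-c)))

  equal-minimum-weights : ∀ r j → ∃[ d ] IsMinWeight (Dual (Code (r + suc j) (suc r))) d × IsMinWeight (Dual (Code (suc j) 1)) d
  equal-minimum-weights r j =
    let s , min = minimum (hyperplanes {j}) hyperplanes-dual (hyperplanes-nonzero {j})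
        (f , df , nz , sf) , _ = min
        c , _ , _ , sc = codeword df nz
        -- The word `c` shows that the minimum `s` is q - 1 times a weight, which then serves as `d`
        -- in both geometries.
        min′ = subst (Minimum (2 + j) 2) (trans (sym sf) sc) min
    in weight c ,
       minimum⇒IsMinWeight (subst₂ (λ a b → Minimum a b ((q ∸ 1) * weight c)) (+-suc r (suc j)) (+-comm r 2) (minimum-lift r min′)) ,
       minimum⇒IsMinWeight min′

theorem4p2 : (p h q n k : ℕ) .{{_ : NonZero p}} → Prime p → q ≡ p ^ h →
    (F : FiniteField q) → 2 ≤ n → 1 ≤ k → k ≤ n ∸ 1 →
    ∃[ d ] (Geometry.IsMinWeight F p (Geometry.Dual F p (Geometry.Code F p n k)) d ×
    Geometry.IsMinWeight F p (Geometry.Dual F p (Geometry.Code F p (n ∸ k + 1) 1)) d)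
theorem4p2 p zero q n k p-prime refl F 2≤n 1≤k k≤n-1 =
  -- For h = 0 the field would have a single element.
  contradiction (Injection.injective (↔⇒↣ enum) (unique _ _)) 0≢1
  where
  open FiniteField F
  unique : (i j : Fin 1) → i ≡ j
  unique Fin.zero Fin.zero = refl
theorem4p2 p (suc h) q n (suc r) p-prime q≡ F 2≤n 1≤k k≤n-1 =
  -- With k = `suc r` and `j = n ∸ k`, the dimensions `r + suc j` and `suc j` are n and n - k + 1.
  subst₂ (λ N M → ∃[ d ] IsMinWeight (Dual (Code N (suc r))) d × IsMinWeight (Dual (Code M 1)) d)
    (trans (+-suc r j) (m+[n∸m]≡n (≤-trans k≤n-1 (m∸n≤m n 1)))) (+-comm 1 j)
    (Words.equal-minimum-weights F p (nonTrivial⇒n>1 p {{prime⇒nonTrivial p-prime}}) (subst (p ∣_) (sym q≡) (m∣m*n (p ^ h))) r j)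
  where
  open Geometry F p
  j = n ∸ suc r
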